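{- Let $F$ be a field, $\kappa$ a regular uncountable cardinal, $i\in B(\kappa)$, and let $W\subseteq\kappa$ be such that $0\in W$ and $\overline{\kappa\setminus W}=i$. Let $L$ be the $F$-linear space and $R\subseteq \mathrm{End}_F(L)$ the $F$-algebra constructed from $F,\kappa,W$ in the context (so $L$ is a right $R$-module). Let $$S=\left\{\begin{pmatrix} f & l\\ 0 & r\end{pmatrix}\ \middle|\ f\in F,\ l\in L,\ r\in R\right\},\qquad I=\left\{\begin{pmatrix} 0 & l\\ 0 & 0\end{pmatrix}\ \middle|\ l\in L\right\},$$ with matrix addition and multiplication. Then $S$ is an $F$-algebra and $I$ is a two-sided ideal of $S$. Let $A$ be the interval in the lattice of all two-sided ideals of $S$ consisting of all two-sided ideals contained in $I$. Then $A$ is a strongly dense lattice of dimension $\kappa$ and $\Gamma(A)=i$.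
   Context: For a regular uncountable cardinal $\kappa$, $B(\kappa)$ is the Boolean algebra of subsets of $\kappa$ modulo the club filter: for $E\subseteq\kappa$, $\overline{E}$ is the class of all $D\subseteq\kappa$ with $D\cap C=E\cap C$ for some closed unbounded $C\subseteq\kappa$. Lattices. Let $A$ be a bounded modular lattice with least element $0$ and greatest element $1$. A c.d.c. of length $\kappa$ in $A$ is a sequence $\mathcal U=(a_\alpha\mid\alpha<\kappa)$ of non-zero elements of $A$ that is continuous ($a_0=1$, and $a_\alpha=\bigwedge_{\beta<\alpha}a_\beta$ for limit $\alpha$), strictly decreasing ($a_{\alpha+1}<a_\alpha$), and cofinal (each non-zero element of $A$ is $\ge$ some $a_\alpha$). $A$ is strongly dense if it has a c.d.c.; its dimension is the least length of a c.d.c. For $0\neq b<a\le1$, $a$ is complemented over $b$ if there is $c\in A$ with $a\wedge c=b$ and $a\vee c=1$. If $A$ is strongly dense of dimension $\kappa$ (regular uncountable), and $\mathcal U$ is a c.d.c. of length $\kappa$, then $E_{\mathcal U}=\{\alpha<\kappa\mid\exists\beta:\alpha<\beta<\kappa$ and $a_\alpha$ is not complemented over $a_\beta\}$, and $\Gamma(A)=\overline{E_{\mathcal U}}\in B(\kappa)$, which does not depend on the choice of $\mathcal U$ (known fact). Construction of $L$ and $R$ from a field $F$, a regular uncountable cardinal $\kappa$ and $W\subseteq\kappa$ with $0\in W$. For $\alpha<\kappa$ let $Y_\alpha$ be the set of all finite sequences $\langle(\alpha_i,\beta_i);i\le n\rangle$, $n<\omega$, with $\alpha_n=\alpha$, $\alpha_i<\beta_i<\kappa$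 for all $i\le n$, $\alpha_i\in W$ for all $0<i\le n$, and $\alpha_i<\alpha_{i+1}$ for all $i<n$. Put $Y=\bigcup_{\alpha<\kappa}Y_\alpha$, $Y_{<\alpha}=\bigcup_{\beta<\alpha}Y_\beta$, $Y_{\ge\alpha}=\bigcup_{\alpha\le\beta<\kappa}Y_\beta$. For $y=\langle(\alpha_i,\beta_i);i\le n\rangle\in Y$ put $\mathrm{amax}(y)=\alpha_n$, $\mathrm{bmax}(y)=\max_{i\le n}\beta_i$. Let $L$ be the $F$-linear space with basis $\{x_\eta\mid\eta\in Y\}$. The symbol $\frown$ denotes appending a pair to a sequence. For $\nu,\rho\in Y$ with $\mathrm{amax}(\rho)\ge\mathrm{bmax}(\nu)$ define $T=T_{\nu\rho}\in\mathrm{End}_F(L)$ (acting on the right) on the basis by induction on the length of $\eta$: - $x_\eta T=0$ if $\nu$ is not an initial segment of $\eta$; - $x_\nu T=x_\rho$; - if $\eta=\eta'\frown(\alpha,\beta)$ with $\nu$ an initial segment of $\eta'$, and $x_{\eta'}T=x_{\rho'}$, then $x_\eta T=x_{\rho'}$ if $\rho'\in Y_{\ge\alpha}$, and $x_\eta T=x_{\rho'\frown(\alpha,\beta)}$ if $\rho'\in Y_{<\alpha}$. $R$ is the unital $F$-subalgebra of $\mathrm{End}_F(L)$ generated by all $T_{\nu\rho}$ with $\nu,\rho\in Y$, $\mathrm{amax}(\rho)\ge\mathrm{bmax}(\nu)$; $L$ is a right $R$-module. -}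

module Defs where

open import Level using (Level; suc; _⊔_)
open import Algebra.Bundles
  using (AbelianGroup; CommutativeMonoid; CommutativeRing; Ring; RawRing)
open import Algebra.Structures using (IsRing)
open import Algebra.Module.Bundles using (LeftModule)
open import Algebra.Module.Structures using (IsLeftModule)
open import Algebra.Module.Morphism.Structures using (IsLeftModuleHomomorphism)
import Algebra.Properties.Ring as RingProperties
import Algebra.Properties.AbelianGroup as AbelianGroupProperties
import Algebra.Properties.CommutativeSemigroup as CommutativeSemigroupProperties
open import Data.Bool.Base using (if_then_else_; true; false)
open import Data.Empty using (⊥-elim)
open import Data.List.Base using (List; []; _∷_; _++_; map; length)
open import Data.Maybe.Base as Maybe using (Maybe; just; nothing; maybe)
open import Data.Nat.Base using (ℕ; z≤n; s≤s) renaming (_≤_ to _≤ℕ_; suc to 1+_)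
open import Data.Maybe.Properties using (just-injective)
import Data.Nat.Properties as ℕ
open import Data.Product
  using (Σ-syntax; ∃-syntax; _×_; _,_; proj₁; proj₂)
open import Data.Sum.Base using (_⊎_; inj₁; inj₂)
open import Function.Base using (_∘_; id)
open import Function.Bundles using (Func; _⇔_)
open import Function.Definitions using (Injective)
open import Induction.WellFounded using (WellFounded)
open import Relation.Binary.Bundles using (DecSetoid)
open import Relation.Binary.Core using (Rel)
open import Relation.Binary.Definitions using (DecidableEquality; _Respects_)
open import Relation.Binary.Lattice.Bundles using (BoundedLattice)
import Relation.Binary.Construct.On as On
open import Relation.Binary.PropositionalEquality as ≡ using (_≡_; refl)
import Relation.Binary.Reasoning.Setoid as SetoidReasoning
open import Relation.Binary.Structures using (IsStrictTotalOrder)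
open import Relation.Nullary using (¬_; yes; no; does)
open import Relation.Nullary.Decidable using (map′; _×-dec_)
open import Relation.Unary using (Pred; _∈_; _∩_; _⊆_; _≐_)

-- An ordinal is presented as a well-ordered type, whose elements are
-- the smaller ordinals.

record Ordinal (a : Level) : Set (suc a) where
  infix 4 _<_ _≤_
  field
    Carrier            : Set a
    _<_                : Rel Carrier a
    isStrictTotalOrder : IsStrictTotalOrder _≡_ _<_
    wellFounded        : WellFounded _<_

  open IsStrictTotalOrder isStrictTotalOrder public using (_≟_; _<?_)

  _≤_ : Rel Carrier a
  α ≤ β = α < β ⊎ α ≡ β

  max : Carrier → Carrier → Carrier
  max α β = if does (α <? β) then β else α

  IsZero : Pred Carrier a
  IsZero α = ∀ β → ¬ β < α

  IsSuccessorOf : Rel Carrier a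
  IsSuccessorOf β α = α < β × (∀ γ → α < γ → ¬ γ < β)

  IsLimit : Pred Carrier a
  IsLimit α = ¬ IsZero α × (∀ β → β < α → ∃[ γ ] β < γ × γ < α)

-- κ ≼ μ compares order types: a strictly increasing map κ → μ exists
-- exactly when the ordinal κ is at most the ordinal μ.

_≼_ : ∀ {a} → Ordinal a → Ordinal a → Set a
κ ≼ μ = Σ[ f ∈ (κ.Carrier → μ.Carrier) ] (∀ α β → α κ.< β → f α μ.< f β)
  where
  module κ = Ordinal κ
  module μ = Ordinal μ

module _ {a} (κ : Ordinal a) where
  open Ordinal κ

  record IsRegularUncountable : Set a where
    field
      -- κ is an initial ordinal: it does not inject into any α < κ.
      cardinal    : ∀ α → ¬ (Σ[ f ∈ (Carrier → Carrier) ]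
                      Injective _≡_ _≡_ f × (∀ β → f β < α))
      uncountable : ¬ (Σ[ f ∈ (Carrier → ℕ) ] Injective _≡_ _≡_ f)
      -- No function from some α < κ to κ is cofinal; only the values
      -- of f below α matter.
      regular     : ∀ α (f : Carrier → Carrier) →
                      ∃[ δ ] (∀ β → β < α → f β < δ)

  record IsClub {p} (C : Pred Carrier p) : Set (a ⊔ p) where
    field
      unbounded : ∀ α → ∃[ β ] α < β × β ∈ C
      closed    : ∀ α → IsLimit α →
                    (∀ β → β < α → ∃[ γ ] β < γ × γ < α × γ ∈ C) → α ∈ C

  -- Elements of B(κ) are given by representatives D ⊆ κ; two of them are
  -- equal in B(κ) when they agree on a closed unbounded set.

  ClubEq : ∀ {d e} → Pred Carrier d → Pred Carrier e → Set (suc a ⊔ d ⊔ e)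
  ClubEq D E =
    Σ[ C ∈ Pred Carrier a ] IsClub C × (∀ α → α ∈ C → (α ∈ D ⇔ α ∈ E))


module _ {c ℓ₁ ℓ₂} (A : BoundedLattice c ℓ₁ ℓ₂) where
  open BoundedLattice A

  IsModular : Set (c ⊔ ℓ₁ ⊔ ℓ₂)
  IsModular = ∀ x y z → x ≤ z → x ∨ (y ∧ z) ≈ (x ∨ y) ∧ z

  ComplementedOver : Rel Carrier (c ⊔ ℓ₁)
  ComplementedOver x y = ∃[ z ] x ∧ z ≈ y × x ∨ z ≈ ⊤

  record CDC {a} (κ : Ordinal a) : Set (a ⊔ c ⊔ ℓ₁ ⊔ ℓ₂) where
    private module κ = Ordinal κ
    field
      term       : κ.Carrier → Carrier
      nonzero    : ∀ α → ¬ term α ≈ ⊥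
      atZero     : ∀ α → κ.IsZero α → term α ≈ ⊤
      -- term α is the greatest lower bound of the earlier terms.
      atLimit    : ∀ α → κ.IsLimit α →
                     (∀ β → β κ.< α → term α ≤ term β) ×
                     (∀ x → (∀ β → β κ.< α → x ≤ term β) → x ≤ term α)
      decreasing : ∀ α β → κ.IsSuccessorOf β α →
                     term β ≤ term α × ¬ term β ≈ term α
      cofinal    : ∀ x → ¬ x ≈ ⊥ → ∃[ α ] term α ≤ x

  -- Lengths range over all ordinals, not only over cardinals.

  record IsStronglyDenseOfDimension {a} (κ : Ordinal a) :
         Set (suc a ⊔ c ⊔ ℓ₁ ⊔ ℓ₂) where
    field
      modular : IsModular
      cdc     : CDC κ
      least   : ∀ (μ : Ordinal a) → CDC μ → κ ≼ μ

  exceptional : ∀ {a} {κ : Ordinal a} → CDC κ →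
                Pred (Ordinal.Carrier κ) (a ⊔ c ⊔ ℓ₁)
  exceptional {κ = κ} U α =
    ∃[ β ] α κ.< β × ¬ ComplementedOver (term α) (term β)
    where
    module κ = Ordinal κ
    open CDC U

  -- Γ(A) = i.  As Γ(A) does not depend on the chain defining it, every
  -- chain of length κ is required to give the class of i.

  Γ≡ : ∀ {a d} (κ : Ordinal a) → Pred (Ordinal.Carrier κ) d →
       Set (suc a ⊔ c ⊔ ℓ₁ ⊔ ℓ₂ ⊔ d)
  Γ≡ κ i = (U : CDC κ) → ClubEq κ (exceptional U) i

record IsField {c ℓ} (F : CommutativeRing c ℓ) : Set (c ⊔ ℓ) where
  open CommutativeRing F
  field
    1≉0     : ¬ 1# ≈ 0#
    inverse : ∀ x → ¬ x ≈ 0# → ∃[ y ] x * y ≈ 1#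

record IsAlgebra {a} (F : CommutativeRing a a) (S : RawRing a a)
                 (_·_ : CommutativeRing.Carrier F →
                        RawRing.Carrier S → RawRing.Carrier S) :
                 Set (suc a) where
  open RawRing S
  field
    isRing       : IsRing _≈_ _+_ _*_ -_ 0# 1#
    isLeftModule : IsLeftModule (CommutativeRing.ring F) _≈_ _+_ 0# -_ _·_
    ·-*-assoc    : ∀ f x y → ((f · x) * y) ≈ (f · (x * y))
    *-·-comm     : ∀ f x y → (x * (f · y)) ≈ (f · (x * y))

  ring : Ring a a
  ring = record { isRing = isRing }

record IsTwoSidedIdeal {c ℓ p} (S : RawRing c ℓ)
                       (J : Pred (RawRing.Carrier S) p) :
                       Set (c ⊔ ℓ ⊔ p) where
  open RawRing S
  field
    respects   : J Respects _≈_
    0∈         : 0# ∈ J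
    +-closed   : ∀ {x y} → x ∈ J → y ∈ J → x + y ∈ J
    neg-closed : ∀ {x} → x ∈ J → - x ∈ J
    absorbˡ    : ∀ s {x} → x ∈ J → s * x ∈ J
    absorbʳ    : ∀ s {x} → x ∈ J → x * s ∈ J

module _ {a} (S : Ring a a) (I : Pred (Ring.Carrier S) a)
         (isI : IsTwoSidedIdeal (Ring.rawRing S) I) where

  open Ring S
  private module I = IsTwoSidedIdeal isI

  record IdealBelow : Set (suc a) where
    field
      ideal           : Pred Carrier a
      isTwoSidedIdeal : IsTwoSidedIdeal rawRing ideal
      below           : ideal ⊆ I
    open IsTwoSidedIdeal isTwoSidedIdeal public

  open IdealBelow

  meet : IdealBelow → IdealBelow → IdealBelow
  meet J K = record
    { ideal = ideal J ∩ ideal K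
    ; isTwoSidedIdeal = record
      { respects = λ x≈y (j , k) → respects J x≈y j , respects K x≈y k
      ; 0∈ = 0∈ J , 0∈ K
      ; +-closed = λ (j , k) (j′ , k′) → +-closed J j j′ , +-closed K k k′
      ; neg-closed = λ (j , k) → neg-closed J j , neg-closed K k
      ; absorbˡ = λ s (j , k) → absorbˡ J s j , absorbˡ K s k
      ; absorbʳ = λ s (j , k) → absorbʳ J s j , absorbʳ K s k
      }
    ; below = λ (j , _) → below J j
    }

  join : IdealBelow → IdealBelow → IdealBelow
  join J K = record
    { ideal = λ x → ∃[ y ] ∃[ z ] y ∈ ideal J × z ∈ ideal K × x ≈ y + z
    ; isTwoSidedIdeal = record
      { respects = λ x≈x′ (y , z , j , k , eq) →
          y , z , j , k , trans (sym x≈x′) eq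
      ; 0∈ = 0# , 0# , 0∈ J , 0∈ K , sym (+-identityˡ 0#)
      ; +-closed = λ (y , z , j , k , eq) (y′ , z′ , j′ , k′ , eq′) →
          y + y′ , z + z′ , +-closed J j j′ , +-closed K k k′ ,
          trans (+-cong eq eq′) (interchange y z y′ z′)
      ; neg-closed = λ (y , z , j , k , eq) →
          - y , - z , neg-closed J j , neg-closed K k ,
          trans (-‿cong eq) (sym (-‿+-comm y z))
      ; absorbˡ = λ s (y , z , j , k , eq) →
          s * y , s * z , absorbˡ J s j , absorbˡ K s k ,
          trans (*-congˡ eq) (distribˡ s y z)
      ; absorbʳ = λ s (y , z , j , k , eq) →
          y * s , z * s , absorbʳ J s j , absorbʳ K s k ,
          trans (*-congʳ eq) (distribʳ s y z)
      }
    ; below = λ (y , z , j , k , eq) →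
        I.respects (sym eq) (I.+-closed (below J j) (below K k))
    }
    where
    open RingProperties S using (-‿+-comm)
    open CommutativeSemigroupProperties
      (CommutativeMonoid.commutativeSemigroup +-commutativeMonoid)
      using (interchange)

  whole : IdealBelow
  whole = record { ideal = I ; isTwoSidedIdeal = isI ; below = id }

  zeroIdeal : IdealBelow
  zeroIdeal = record
    { ideal = _≈ 0#
    ; isTwoSidedIdeal = record
      { respects = λ x≈y x≈0 → trans (sym x≈y) x≈0
      ; 0∈ = refl′
      ; +-closed = λ p q → trans (+-cong p q) (+-identityˡ 0#)
      ; neg-closed = λ p → trans (-‿cong p) -0#≈0#
      ; absorbˡ = λ s p → trans (*-congˡ p) (zeroʳ s)
      ; absorbʳ = λ s p → trans (*-congʳ p) (zeroˡ s)
      }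
    ; below = λ x≈0 → I.respects (sym x≈0) I.0∈
    }
    where
    open RingProperties S using (-0#≈0#)
    refl′ = Ring.refl S

  idealInterval : BoundedLattice (suc a) a a
  idealInterval = record
    { Carrier = IdealBelow
    ; _≈_ = λ J K → ideal J ≐ ideal K
    ; _≤_ = λ J K → ideal J ⊆ ideal K
    ; _∨_ = join
    ; _∧_ = meet
    ; ⊤ = whole
    ; ⊥ = zeroIdeal
    ; isBoundedLattice = record
      { isLattice = record
        { isPartialOrder = record
          { isPreorder = record
            { isEquivalence = record
              { refl = id , id
              ; sym = λ (f , g) → g , f
              ; trans = λ (f , g) (f′ , g′) → f′ ∘ f , g ∘ g′
              }
            ; reflexive = proj₁
            ; trans = λ f g → g ∘ f
            }
          ; antisym = _,_
          }
        ; supremum = λ J K →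
            (λ {x} j → x , 0# , j , 0∈ K , sym (+-identityʳ x)) ,
            (λ {x} k → 0# , x , 0∈ J , k , sym (+-identityˡ x)) ,
            λ M f g (_ , _ , j , k , eq) →
              respects M (sym eq) (+-closed M (f j) (g k))
        ; infimum = λ J K → proj₁ , proj₂ , λ M f g m → f m , g m
        }
      ; maximum = below
      ; minimum = λ J x≈0 → respects J (sym x≈0) (0∈ J)
      }
    }

module Free {a} (F : CommutativeRing a a) (Y : DecSetoid a a) where
  private module Y = DecSetoid Y
  open CommutativeRing F hiding (refl)
  private
    refl′ : ∀ {x} → x ≈ x
    refl′ = CommutativeRing.refl F
  open RingProperties ring using (-0#≈0#; -‿distribʳ-*; -‿+-comm)

  -- Formal linear combinations, identified when all coefficients agree.

  Combination : Set a
  Combination = List (Carrier × Y.Carrier)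

  coeff : Combination → Y.Carrier → Carrier
  coeff []            y = 0#
  coeff ((c , z) ∷ v) y = (if does (z Y.≟ y) then c else 0#) + coeff v y

  infix 4 _≈ᶜ_
  _≈ᶜ_ : Rel Combination a
  v ≈ᶜ w = ∀ y → coeff v y ≈ coeff w y

  scale : Carrier → Combination → Combination
  scale c = map λ (d , y) → c * d , y

  neg : Combination → Combination
  neg = map λ (d , y) → - d , y

  basis : Y.Carrier → Combination
  basis y = (1# , y) ∷ []

  coeff-++ : ∀ v w y → coeff (v ++ w) y ≈ coeff v y + coeff w y
  coeff-++ []            w y = sym (+-identityˡ _)
  coeff-++ ((c , z) ∷ v) w y =
    trans (+-congˡ (coeff-++ v w y)) (sym (+-assoc _ _ _))

  coeff-scale : ∀ c v y → coeff (scale c v) y ≈ c * coeff v y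
  coeff-scale c []            y = sym (zeroʳ c)
  coeff-scale c ((d , z) ∷ v) y =
    trans (+-cong (lemma (does (z Y.≟ y))) (coeff-scale c v y))
          (sym (distribˡ c _ _))
    where
    lemma : ∀ b → (if b then c * d else 0#) ≈ c * (if b then d else 0#)
    lemma false = sym (zeroʳ c)
    lemma true  = refl′

  coeff-neg : ∀ v y → coeff (neg v) y ≈ - coeff v y
  coeff-neg []            y = sym -0#≈0#
  coeff-neg ((d , z) ∷ v) y =
    trans (+-cong (lemma (does (z Y.≟ y))) (coeff-neg v y)) (-‿+-comm _ _)
    where
    lemma : ∀ b → (if b then - d else 0#) ≈ - (if b then d else 0#)
    lemma false = sym -0#≈0#
    lemma true  = refl′

  private
    ++-cong : ∀ {v v′ w w′} → v ≈ᶜ v′ → w ≈ᶜ w′ → v ++ w ≈ᶜ v′ ++ w′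
    ++-cong {v} {v′} {w} {w′} p q y =
      trans (coeff-++ v w y)
        (trans (+-cong (p y) (q y)) (sym (coeff-++ v′ w′ y)))

  leftModule : LeftModule ring a a
  leftModule = record
    { Carrierᴹ = Combination
    ; _≈ᴹ_ = _≈ᶜ_
    ; _+ᴹ_ = _++_
    ; _*ₗ_ = scale
    ; 0ᴹ = []
    ; -ᴹ_ = neg
    ; isLeftModule = record
      { isLeftSemimodule = record
        { +ᴹ-isCommutativeMonoid = record
          { isMonoid = record
            { isSemigroup = record
              { isMagma = record
                { isEquivalence = record
                  { refl = λ _ → refl′
                  ; sym = λ p y → sym (p y)
                  ; trans = λ p q y → trans (p y) (q y)
                  }
                ; ∙-cong = λ {v} {v′} {w} {w′} → ++-cong {v} {v′} {w} {w′}
                }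
              ; assoc = λ u v w y → trans (coeff-++ (u ++ v) w y)
                  (trans (+-congʳ (coeff-++ u v y))
                  (trans (+-assoc _ _ _)
                  (trans (+-congˡ (sym (coeff-++ v w y)))
                         (sym (coeff-++ u (v ++ w) y)))))
              }
            ; identity = (λ _ _ → refl′) ,
                λ v y → trans (coeff-++ v [] y) (+-identityʳ _)
            }
          ; comm = λ v w y → trans (coeff-++ v w y)
              (trans (+-comm _ _) (sym (coeff-++ w v y)))
          }
        ; isPreleftSemimodule = record
          { *ₗ-cong = λ {c} {d} {v} {w} c≈d v≈w y →
              trans (coeff-scale c v y)
                (trans (*-cong c≈d (v≈w y)) (sym (coeff-scale d w y)))
          ; *ₗ-zeroˡ = λ v y → trans (coeff-scale 0# v y) (zeroˡ _)
          ; *ₗ-distribʳ = λ v c d y → trans (coeff-scale (c + d) v y)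
              (trans (distribʳ _ c d)
              (trans (+-cong (sym (coeff-scale c v y)) (sym (coeff-scale d v y)))
                     (sym (coeff-++ (scale c v) (scale d v) y))))
          ; *ₗ-identityˡ = λ v y → trans (coeff-scale 1# v y) (*-identityˡ _)
          ; *ₗ-assoc = λ c d v y → trans (coeff-scale (c * d) v y)
              (trans (*-assoc c d _)
              (trans (*-congˡ (sym (coeff-scale d v y)))
                     (sym (coeff-scale c (scale d v) y))))
          ; *ₗ-zeroʳ = λ _ _ → refl′
          ; *ₗ-distribˡ = λ c v w y → trans (coeff-scale c (v ++ w) y)
              (trans (*-congˡ (coeff-++ v w y))
              (trans (distribˡ c _ _)
              (trans (+-cong (sym (coeff-scale c v y)) (sym (coeff-scale c w y)))
                     (sym (coeff-++ (scale c v) (scale c w) y)))))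
          }
        }
      ; -ᴹ‿cong = λ {v} {w} p y → trans (coeff-neg v y)
          (trans (-‿cong (p y)) (sym (coeff-neg w y)))
      ; -ᴹ‿inverse =
          (λ v y → trans (coeff-++ (neg v) v y)
            (trans (+-congʳ (coeff-neg v y)) (-‿inverseˡ _))) ,
          (λ v y → trans (coeff-++ v (neg v) y)
            (trans (+-congˡ (coeff-neg v y)) (-‿inverseʳ _)))
      }
    }

  module Extension (M : LeftModule ring a a)
                   (g : Func Y.setoid (LeftModule.≈ᴹ-setoid M)) where
    private module M = LeftModule M
    open M using (_≈ᴹ_; _+ᴹ_; _*ₗ_; 0ᴹ; -ᴹ_)
    open Func g renaming (to to ⟦_⟧; cong to ⟦⟧-cong)

    extend : Combination → M.Carrierᴹ
    extend []            = 0ᴹ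
    extend ((c , y) ∷ v) = c *ₗ ⟦ y ⟧ +ᴹ extend v

    extend-++ : ∀ v w → extend (v ++ w) ≈ᴹ extend v +ᴹ extend w
    extend-++ []            w = M.≈ᴹ-sym (M.+ᴹ-identityˡ _)
    extend-++ ((c , y) ∷ v) w =
      M.≈ᴹ-trans (M.+ᴹ-congˡ (extend-++ v w)) (M.≈ᴹ-sym (M.+ᴹ-assoc _ _ _))

    extend-scale : ∀ c v → extend (scale c v) ≈ᴹ c *ₗ extend v
    extend-scale c []            = M.≈ᴹ-sym (M.*ₗ-zeroʳ c)
    extend-scale c ((d , y) ∷ v) =
      M.≈ᴹ-trans (M.+ᴹ-cong (M.*ₗ-assoc c d _) (extend-scale c v))
                 (M.≈ᴹ-sym (M.*ₗ-distribˡ c _ _))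

    private
      open SetoidReasoning M.≈ᴹ-setoid

      open AbelianGroupProperties M.+ᴹ-abelianGroup
        using (inverseˡ-unique; ε⁻¹≈ε; ⁻¹-∙-comm; ⁻¹-involutive)
      open CommutativeSemigroupProperties
        (CommutativeMonoid.commutativeSemigroup
          (AbelianGroup.commutativeMonoid M.+ᴹ-abelianGroup))
        using (x∙yz≈y∙xz)

      neg-*ₗ : ∀ c m → (- c) *ₗ m ≈ᴹ -ᴹ (c *ₗ m)
      neg-*ₗ c m = inverseˡ-unique _ _ (begin
        (- c) *ₗ m +ᴹ c *ₗ m ≈⟨ M.*ₗ-distribʳ m (- c) c ⟨
        (- c + c) *ₗ m       ≈⟨ M.*ₗ-congʳ (-‿inverseˡ c) ⟩
        0# *ₗ m              ≈⟨ M.*ₗ-zeroˡ m ⟩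
        0ᴹ                   ∎)

    extend-neg : ∀ v → extend (neg v) ≈ᴹ -ᴹ extend v
    extend-neg []            = M.≈ᴹ-sym ε⁻¹≈ε
    extend-neg ((d , y) ∷ v) =
      M.≈ᴹ-trans (M.+ᴹ-cong (neg-*ₗ d _) (extend-neg v)) (⁻¹-∙-comm _ _)

    private
      remove : Y.Carrier → Combination → Combination
      remove y [] = []
      remove y ((c , z) ∷ v) with z Y.≟ y
      ... | yes _ = remove y v
      ... | no  _ = (c , z) ∷ remove y v

      length-remove : ∀ y v → length (remove y v) ≤ℕ length v
      length-remove y [] = z≤n
      length-remove y ((c , z) ∷ v) with z Y.≟ y
      ... | yes _ = ℕ.m≤n⇒m≤1+n (length-remove y v)
      ... | no  _ = s≤s (length-remove y v)

      split : ∀ y v → extend v ≈ᴹ coeff v y *ₗ ⟦ y ⟧ +ᴹ extend (remove y v)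
      split y [] = M.≈ᴹ-sym (M.≈ᴹ-trans (M.+ᴹ-identityʳ _) (M.*ₗ-zeroˡ _))
      split y ((c , z) ∷ v) with z Y.≟ y
      ... | yes z≈y = begin
        c *ₗ ⟦ z ⟧ +ᴹ extend v
          ≈⟨ M.+ᴹ-cong (M.*ₗ-congˡ (⟦⟧-cong z≈y)) (split y v) ⟩
        c *ₗ ⟦ y ⟧ +ᴹ (coeff v y *ₗ ⟦ y ⟧ +ᴹ extend (remove y v))
          ≈⟨ M.+ᴹ-assoc _ _ _ ⟨
        c *ₗ ⟦ y ⟧ +ᴹ coeff v y *ₗ ⟦ y ⟧ +ᴹ extend (remove y v)
          ≈⟨ M.+ᴹ-congʳ (M.*ₗ-distribʳ _ _ _) ⟨
        (c + coeff v y) *ₗ ⟦ y ⟧ +ᴹ extend (remove y v) ∎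
      ... | no _ = begin
        c *ₗ ⟦ z ⟧ +ᴹ extend v
          ≈⟨ M.+ᴹ-congˡ (split y v) ⟩
        c *ₗ ⟦ z ⟧ +ᴹ (coeff v y *ₗ ⟦ y ⟧ +ᴹ extend (remove y v))
          ≈⟨ x∙yz≈y∙xz _ _ _ ⟩
        coeff v y *ₗ ⟦ y ⟧ +ᴹ (c *ₗ ⟦ z ⟧ +ᴹ extend (remove y v))
          ≈⟨ M.+ᴹ-congʳ (M.*ₗ-congʳ (+-identityˡ _)) ⟨
        (0# + coeff v y) *ₗ ⟦ y ⟧ +ᴹ (c *ₗ ⟦ z ⟧ +ᴹ extend (remove y v)) ∎

      coeff-remove : ∀ y v → v ≈ᶜ [] → remove y v ≈ᶜ []
      coeff-remove y v v≈0 x with y Y.≟ x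
      ... | yes y≈x = hit v
        where
        hit : ∀ w → coeff (remove y w) x ≈ 0#
        hit [] = refl′
        hit ((c , z) ∷ w) with z Y.≟ y
        ... | yes _ = hit w
        ... | no z≉y with z Y.≟ x
        ...   | yes z≈x = ⊥-elim (z≉y (Y.trans z≈x (Y.sym y≈x)))
        ...   | no  _   = trans (+-identityˡ _) (hit w)
      ... | no y≉x = trans (miss v) (v≈0 x)
        where
        miss : ∀ w → coeff (remove y w) x ≈ coeff w x
        miss [] = refl′
        miss ((c , z) ∷ w) with z Y.≟ y
        ... | no  _   = +-congˡ (miss w)
        ... | yes z≈y with z Y.≟ x
        ...   | yes z≈x = ⊥-elim (y≉x (Y.trans (Y.sym z≈y) z≈x))
        ...   | no  _   = trans (miss w) (sym (+-identityˡ _))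

      extend-null : ∀ n v → length v ≤ℕ n → v ≈ᶜ [] → extend v ≈ᴹ 0ᴹ
      extend-null _ [] _ _ = M.≈ᴹ-refl
      extend-null (1+ n) v@((c , y) ∷ w) (s≤s w≤n) v≈0 = begin
        extend v
          ≈⟨ split y v ⟩
        coeff v y *ₗ ⟦ y ⟧ +ᴹ extend (remove y v)
          ≈⟨ M.+ᴹ-cong (M.*ₗ-congʳ (v≈0 y))
               (extend-null n (remove y v) shorter (coeff-remove y v v≈0)) ⟩
        0# *ₗ ⟦ y ⟧ +ᴹ 0ᴹ
          ≈⟨ M.+ᴹ-identityʳ _ ⟩
        0# *ₗ ⟦ y ⟧
          ≈⟨ M.*ₗ-zeroˡ _ ⟩
        0ᴹ ∎
        where
        shorter : length (remove y v) ≤ℕ n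
        shorter with y Y.≟ y
        ... | yes _  = ℕ.≤-trans (length-remove y w) w≤n
        ... | no y≉y = ⊥-elim (y≉y Y.refl)

    extend-cong : ∀ {v w} → v ≈ᶜ w → extend v ≈ᴹ extend w
    extend-cong {v} {w} v≈w =
      M.≈ᴹ-trans (inverseˡ-unique _ _ (M.≈ᴹ-trans
        (M.≈ᴹ-sym (M.≈ᴹ-trans (extend-++ v (neg w)) (M.+ᴹ-congˡ (extend-neg w))))
        (extend-null _ (v ++ neg w) ℕ.≤-refl difference)))
        (⁻¹-involutive _)
      where
      difference : v ++ neg w ≈ᶜ []
      difference y = trans (coeff-++ v (neg w) y)
        (trans (+-cong (v≈w y) (coeff-neg w y)) (-‿inverseʳ _))

    extend-isHomomorphism :
      IsLeftModuleHomomorphism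
        (LeftModule.rawLeftModule leftModule) M.rawLeftModule extend
    extend-isHomomorphism = record
      { +ᴹ-isGroupHomomorphism = record
        { isMonoidHomomorphism = record
          { isMagmaHomomorphism = record
            { isRelHomomorphism = record { cong = λ {v} {w} → extend-cong {v} {w} }
            ; homo = extend-++
            }
          ; ε-homo = M.≈ᴹ-refl
          }
        ; ⁻¹-homo = extend-neg
        }
      ; *ₗ-homo = extend-scale
      }

module Endomorphisms {a} (F : CommutativeRing a a)
                     (M : LeftModule (CommutativeRing.ring F) a a) where
  open CommutativeRing F using () renaming (Carrier to K)
  private module F = CommutativeRing F
  open LeftModule M
  open AbelianGroupProperties +ᴹ-abelianGroup
    using (inverseˡ-unique; ε⁻¹≈ε; ⁻¹-∙-comm)
  open CommutativeSemigroupProperties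
    (CommutativeMonoid.commutativeSemigroup
      (AbelianGroup.commutativeMonoid +ᴹ-abelianGroup))
    using (interchange)

  record End : Set a where
    constructor end
    field
      apply  : Carrierᴹ → Carrierᴹ
      isHomo : IsLeftModuleHomomorphism rawLeftModule rawLeftModule apply
    open IsLeftModuleHomomorphism isHomo public
      using (+ᴹ-homo; 0ᴹ-homo; -ᴹ-homo; *ₗ-homo) renaming (⟦⟧-cong to apply-cong)

  open End

  infixl 7 _▷_
  _▷_ : Carrierᴹ → End → Carrierᴹ
  v ▷ t = apply t v

  infix 4 _≈ᴱ_
  _≈ᴱ_ : Rel End a
  t ≈ᴱ u = ∀ v → v ▷ t ≈ᴹ v ▷ u

  private
    mkEnd : (f : Carrierᴹ → Carrierᴹ) →
            (∀ {v w} → v ≈ᴹ w → f v ≈ᴹ f w) →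
            (∀ v w → f (v +ᴹ w) ≈ᴹ f v +ᴹ f w) →
            (∀ c v → f (c *ₗ v) ≈ᴹ c *ₗ f v) → End
    mkEnd f f-cong f-+ f-* = end f (record
      { +ᴹ-isGroupHomomorphism = record
        { isMonoidHomomorphism = record
          { isMagmaHomomorphism = record
            { isRelHomomorphism = record { cong = f-cong }
            ; homo = f-+
            }
          ; ε-homo = f-0
          }
        ; ⁻¹-homo = λ v → inverseˡ-unique _ _
            (≈ᴹ-trans (≈ᴹ-sym (f-+ _ _))
            (≈ᴹ-trans (f-cong (-ᴹ‿inverseˡ v)) f-0))
        }
      ; *ₗ-homo = f-*
      })
      where
      f-0 : f 0ᴹ ≈ᴹ 0ᴹ
      f-0 = ≈ᴹ-trans (f-cong (≈ᴹ-sym (*ₗ-zeroˡ 0ᴹ)))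
              (≈ᴹ-trans (f-* F.0# 0ᴹ) (*ₗ-zeroˡ _))

    *ₗ-swap : ∀ c d v → c *ₗ d *ₗ v ≈ᴹ d *ₗ c *ₗ v
    *ₗ-swap c d v = ≈ᴹ-trans (≈ᴹ-sym (*ₗ-assoc c d v))
      (≈ᴹ-trans (*ₗ-congʳ (F.*-comm c d)) (*ₗ-assoc d c v))

    neg-*ₗ : ∀ c v → -ᴹ (c *ₗ v) ≈ᴹ c *ₗ (-ᴹ v)
    neg-*ₗ c v = ≈ᴹ-sym (inverseˡ-unique _ _
      (≈ᴹ-trans (≈ᴹ-sym (*ₗ-distribˡ c (-ᴹ v) v))
      (≈ᴹ-trans (*ₗ-congˡ (-ᴹ‿inverseˡ v)) (*ₗ-zeroʳ c))))

  0ᴱ 1ᴱ : End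
  0ᴱ = mkEnd (λ _ → 0ᴹ) (λ _ → ≈ᴹ-refl)
         (λ _ _ → ≈ᴹ-sym (+ᴹ-identityˡ 0ᴹ)) (λ c _ → ≈ᴹ-sym (*ₗ-zeroʳ c))
  1ᴱ = mkEnd id id (λ _ _ → ≈ᴹ-refl) (λ _ _ → ≈ᴹ-refl)

  infixl 6 _+ᴱ_
  _+ᴱ_ : End → End → End
  t +ᴱ u = mkEnd (λ v → v ▷ t +ᴹ v ▷ u)
    (λ v≈w → +ᴹ-cong (apply-cong t v≈w) (apply-cong u v≈w))
    (λ v w → ≈ᴹ-trans (+ᴹ-cong (+ᴹ-homo t v w) (+ᴹ-homo u v w))
                      (interchange _ _ _ _))
    (λ c v → ≈ᴹ-trans (+ᴹ-cong (*ₗ-homo t c v) (*ₗ-homo u c v))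
                      (≈ᴹ-sym (*ₗ-distribˡ c _ _)))

  -ᴱ_ : End → End
  -ᴱ t = mkEnd (λ v → -ᴹ (v ▷ t))
    (λ v≈w → -ᴹ‿cong (apply-cong t v≈w))
    (λ v w → ≈ᴹ-trans (-ᴹ‿cong (+ᴹ-homo t v w)) (≈ᴹ-sym (⁻¹-∙-comm _ _)))
    (λ c v → ≈ᴹ-trans (-ᴹ‿cong (*ₗ-homo t c v)) (neg-*ₗ c _))

  -- Since endomorphisms act on the right, t comes first in t *ᴱ u.

  infixl 7 _*ᴱ_
  _*ᴱ_ : End → End → End
  t *ᴱ u = mkEnd (λ v → v ▷ t ▷ u)
    (λ v≈w → apply-cong u (apply-cong t v≈w))
    (λ v w → ≈ᴹ-trans (apply-cong u (+ᴹ-homo t v w)) (+ᴹ-homo u _ _))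
    (λ c v → ≈ᴹ-trans (apply-cong u (*ₗ-homo t c v)) (*ₗ-homo u c _))

  infixr 7 _·ᴱ_
  _·ᴱ_ : K → End → End
  c ·ᴱ t = mkEnd (λ v → c *ₗ (v ▷ t))
    (λ v≈w → *ₗ-congˡ (apply-cong t v≈w))
    (λ v w → ≈ᴹ-trans (*ₗ-congˡ (+ᴹ-homo t v w)) (*ₗ-distribˡ c _ _))
    (λ d v → ≈ᴹ-trans (*ₗ-congˡ (*ₗ-homo t d v)) (*ₗ-swap c d _))

  data Generated (G : Pred End a) : Pred End a where
    generator : ∀ {t} → t ∈ G → t ∈ Generated G
    respects  : ∀ {t u} → t ≈ᴱ u → t ∈ Generated G → u ∈ Generated G
    0∈        : 0ᴱ ∈ Generated G
    1∈        : 1ᴱ ∈ Generated G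
    +-closed  : ∀ {t u} → t ∈ Generated G → u ∈ Generated G →
                t +ᴱ u ∈ Generated G
    neg-closed : ∀ {t} → t ∈ Generated G → -ᴱ t ∈ Generated G
    *-closed  : ∀ {t u} → t ∈ Generated G → u ∈ Generated G →
                t *ᴱ u ∈ Generated G
    ·-closed  : ∀ c {t} → t ∈ Generated G → c ·ᴱ t ∈ Generated G

module Construction {a} (F : CommutativeRing a a) (κ : Ordinal a)
                    (W : Pred (Ordinal.Carrier κ) a) where
  open Ordinal κ using (_<_; _≤_; _≟_; _<?_; max) renaming (Carrier to K)

  infixl 5 _⌢_
  data Seq : Set a where
    ⟨_⟩ : K × K → Seq
    _⌢_ : Seq → K × K → Seq

  amax : Seq → K
  amax ⟨ α , _ ⟩     = α
  amax (_ ⌢ (α , _)) = α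

  bmax : Seq → K
  bmax ⟨ _ , β ⟩     = β
  bmax (s ⌢ (_ , β)) = max (bmax s) β

  -- The first α₀ need not lie in W.

  Valid : Pred Seq a
  Valid ⟨ α , β ⟩     = α < β
  Valid (s ⌢ (α , β)) = Valid s × amax s < α × α < β × α ∈ W

  _≟ˢ_ : DecidableEquality Seq
  ⟨ α , β ⟩     ≟ˢ ⟨ γ , δ ⟩ =
    map′ (λ { (refl , refl) → refl }) (λ { refl → refl , refl })
         (α ≟ γ ×-dec β ≟ δ)
  ⟨ _ ⟩         ≟ˢ (_ ⌢ _)   = no λ ()
  (_ ⌢ _)       ≟ˢ ⟨ _ ⟩     = no λ ()
  (s ⌢ (α , β)) ≟ˢ (t ⌢ (γ , δ)) =
    map′ (λ { (refl , refl , refl) → refl })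
         (λ { refl → refl , refl , refl })
         (s ≟ˢ t ×-dec (α ≟ γ ×-dec β ≟ δ))

  -- Elements of Y are compared through their underlying sequences only.

  record Y : Set a where
    constructor _,_
    field
      seq   : Seq
      valid : Valid seq

  open Y

  Y-decSetoid : DecSetoid a a
  Y-decSetoid = record
    { isDecEquivalence = On.isDecEquivalence seq (≡.isDecEquivalence _≟ˢ_) }

  open Free F Y-decSetoid using (basis; module Extension) public
  L : LeftModule (CommutativeRing.ring F) a a
  L = Free.leftModule F Y-decSetoid

  private module L = LeftModule L

  append : ∀ {α β} → α < β → α ∈ W → Y → Y
  append {α} {β} α<β α∈W (s , s-valid) with amax s <? α
  ... | yes s<α = s ⌢ (α , β) , (s-valid , s<α , α<β , α∈W)
  ... | no  _   = s , s-valid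

  -- image ν ρ η is the ρ′ with x_η T = x_ρ′, or nothing if x_η T = 0.
  -- The recursion shortens η from its end until it reaches the initial
  -- segment ν, if there is one.

  module _ (ν ρ : Y) where

    imageSeq : ∀ s → Valid s → Maybe Y
    imageSeq s s-valid with s ≟ˢ seq ν
    imageSeq s _ | yes _ = just ρ
    imageSeq ⟨ _ ⟩ _ | no _ = nothing
    imageSeq (s ⌢ _) (s-valid , _ , α<β , α∈W) | no _ =
      Maybe.map (append α<β α∈W) (imageSeq s s-valid)

    image : Y → Maybe Y
    image (s , s-valid) = imageSeq s s-valid

    onBasis : Y → L.Carrierᴹ
    onBasis η = maybe basis L.0ᴹ (image η)

    private
      append-seq : ∀ {α β} (p p′ : α < β) (q q′ : α ∈ W) η θ →
                   seq η ≡ seq θ → seq (append p q η) ≡ seq (append p′ q′ θ)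
      append-seq {α} p p′ q q′ (s , _) (.s , _) refl with amax s <? α
      ... | yes _ = refl
      ... | no  _ = refl

      imageSeq-irrelevant : ∀ s (p q : Valid s) →
        Maybe.map seq (imageSeq s p) ≡ Maybe.map seq (imageSeq s q)
      imageSeq-irrelevant s p q with s ≟ˢ seq ν
      imageSeq-irrelevant s p q | yes _ = refl
      imageSeq-irrelevant ⟨ _ ⟩ p q | no _ = refl
      imageSeq-irrelevant (s ⌢ _) (p , _ , p₁ , p₂) (q , _ , q₁ , q₂) | no _
        with imageSeq s p | imageSeq s q | imageSeq-irrelevant s p q
      ... | nothing | nothing | _  = refl
      ... | just η  | just θ  | eq =
        ≡.cong just (append-seq p₁ q₁ p₂ q₂ η θ (just-injective eq))

      basis-cong : ∀ η θ → seq η ≡ seq θ → basis η L.≈ᴹ basis θ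
      basis-cong (s , _) (.s , _) refl (t , _) = CommutativeRing.refl F

      onBasis-cong : ∀ η θ → seq η ≡ seq θ → onBasis η L.≈ᴹ onBasis θ
      onBasis-cong (s , p) (.s , q) refl
        with imageSeq s p | imageSeq s q | imageSeq-irrelevant s p q
      ... | nothing | nothing | _  = L.≈ᴹ-refl {L.0ᴹ}
      ... | just η  | just θ  | eq = basis-cong η θ (just-injective eq)

    onBasis-func : Func (DecSetoid.setoid Y-decSetoid) L.≈ᴹ-setoid
    onBasis-func = record
      { to = onBasis ; cong = λ {η} {θ} → onBasis-cong η θ }

    open Extension L onBasis-func using (extend; extend-isHomomorphism)
    open Endomorphisms F L using (End; end)

    T : End
    T = end extend extend-isHomomorphism

  open Endomorphisms F L

  Generator : Pred End a
  Generator t =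
    Σ[ ν ∈ Y ] Σ[ ρ ∈ Y ] bmax (seq ν) ≤ amax (seq ρ) × t ≈ᴱ T ν ρ

  R : Pred End a
  R = Generated Generator

  record Matrix : Set a where
    constructor matrix
    field
      f   : CommutativeRing.Carrier F
      l   : L.Carrierᴹ
      r   : End
      r∈R : r ∈ R

  private module F = CommutativeRing F

  S : RawRing a a
  S = record
    { Carrier = Matrix
    ; _≈_ = λ (matrix f l r _) (matrix f′ l′ r′ _) →
        f F.≈ f′ × l L.≈ᴹ l′ × r ≈ᴱ r′
    ; _+_ = λ (matrix f l r p) (matrix f′ l′ r′ p′) →
        matrix (f F.+ f′) (l L.+ᴹ l′) (r +ᴱ r′) (+-closed p p′)
    ; _*_ = λ (matrix f l r p) (matrix f′ l′ r′ p′) →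
        matrix (f F.* f′) (f L.*ₗ l′ L.+ᴹ l ▷ r′) (r *ᴱ r′) (*-closed p p′)
    ; -_ = λ (matrix f l r p) →
        matrix (F.- f) (L.-ᴹ l) (-ᴱ r) (neg-closed p)
    ; 0# = matrix F.0# L.0ᴹ 0ᴱ 0∈
    ; 1# = matrix F.1# L.0ᴹ 1ᴱ 1∈
    }

  _·_ : F.Carrier → Matrix → Matrix
  c · matrix f l r p = matrix (c F.* f) (c L.*ₗ l) (c ·ᴱ r) (·-closed c p)

  I : Pred Matrix a
  I x = Σ[ l ∈ L.Carrierᴹ ] RawRing._≈_ S x (matrix F.0# l 0ᴱ 0∈)

-- An ideal of S below I is an R-submodule of L, and the submodules V_α spanned by
-- the x_η with amax η ≥ α form a c.d.c.: if η is a longest sequence occurring in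
-- v ≠ 0, then v T_{ηρ} is a non-zero multiple of x_ρ, so vR contains V_{bmax η}.
-- If α ∈ W and α < β, then appending (α,β) to the sequences below α defines a
-- projection π of L onto V_α which commutes with R modulo V_β, so that
-- {v | vπ ∈ V_β} is a complement of V_α over V_β.  If α ∉ W, then no x_ρ with
-- amax ρ = α occurs in V_α T_{νρ} when amax ν < α, and V_α is not complemented over
-- any later V_β.  Hence the exceptional set of this chain is the complement of W;
-- any other chain of length κ agrees with this one on a closed unbounded set.

module Submission where

open import Defs
open import Algebra.Bundles
  using (AbelianGroup; CommutativeMonoid; CommutativeRing; RawRing; Ring)
open import Algebra.Module.Bundles using (LeftModule)
import Algebra.Properties.AbelianGroup as AbelianGroupProperties
import Algebra.Properties.CommutativeSemigroup as CommutativeSemigroupProperties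
import Algebra.Properties.Ring as RingProperties
open import Algebra.Structures using (IsRing)
open import Axiom.ExcludedMiddle using (ExcludedMiddle)
open import Data.Bool.Base using (if_then_else_)
open import Data.List.Base using ([]; _∷_; _++_)
open import Data.Maybe.Base as Maybe using (Maybe; just; nothing; maybe)
open import Data.Nat.Base as ℕ using (ℕ)
import Data.Nat.Properties as ℕ
open import Data.Product using (Σ-syntax; ∃-syntax; _×_; _,_; proj₁; proj₂)
open import Data.Sum.Base using (_⊎_; inj₁; inj₂)
open import Function.Base using (_∘_)
open import Function.Bundles using (Equivalence; Func; _⇔_; mk⇔)
open import Function.Construct.Composition using (_⇔-∘_)
open import Induction.WellFounded using (Acc; acc; module All; module FixPoint)
open import Level using (_⊔_) renaming (suc to lsuc)
open import Relation.Binary.Bundles using (DecSetoid)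
open import Relation.Binary.Definitions using (tri<; tri≈; tri>)
open import Relation.Binary.Lattice.Bundles using (BoundedLattice)
import Relation.Binary.Lattice.Properties.JoinSemilattice as JoinProperties
import Relation.Binary.Lattice.Properties.MeetSemilattice as MeetProperties
open import Relation.Binary.PropositionalEquality as ≡ using (_≡_; refl; subst)
import Relation.Binary.Reasoning.Setoid as SetoidReasoning
open import Relation.Binary.Structures using (IsStrictTotalOrder)
open import Relation.Nullary using (¬_; yes; no; does; contradiction)
open import Relation.Nullary.Decidable using (decidable-stable)
open import Relation.Unary using (Pred; _∈_; _⊆_; _∩_; ∁)

-- Regular uncountable ordinals

-- The condition bmax ν ≤ amax ρ carries the argument, in both directions. Since amax ν < bmax ν, no
-- T lowers amax, so every V_α is invariant. Since β counts in bmax, appending (α,β) fails to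
-- commute with T only when it produces ν itself; the error is then x_ρ with amax ρ ≥ β, which
-- vanishes modulo V_β. On the other hand the condition still allows bmax ν = amax ρ = α. This
-- defeats complements when α is outside W: ν = ⟨(ζ,α)⟩ has amax ν = ζ < α, and yet T sends x_ν to
-- x_ρ with amax ρ = α. Such a ζ exists because 0 ∈ W. The passage to arbitrary chains rests on
-- modularity: a complement of x over y′ yields one over every y between y′ and x, so whether α is
-- exceptional depends only on the term at α. Two chains of length κ, each cofinal below the other,
-- have the same meet at every limit closed under a suitable function, and such limits are unbounded
-- because κ has uncountable cofinality. A competing length μ may be any ordinal, so minimality of κ
-- is proved by embedding κ into μ.

¬∀⇒∃¬ : (∀ {ℓ} → ExcludedMiddle ℓ) →
        ∀ {a p} {A : Set a} {P : Pred A p} → ¬ (∀ x → P x) → ∃[ x ] ¬ P x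
¬∀⇒∃¬ em ¬∀ = decidable-stable em λ ¬∃ →
  ¬∀ λ x → decidable-stable em λ ¬p → ¬∃ (x , ¬p)

module OrdinalProperties (em : ∀ {ℓ} → ExcludedMiddle ℓ) {a} (κ : Ordinal a) where
  open Ordinal κ
  open IsStrictTotalOrder isStrictTotalOrder public
    using (compare) renaming (trans to <-trans; irrefl to <-irrefl)

  ≤-refl : ∀ {α} → α ≤ α
  ≤-refl = inj₂ refl

  <-≤-trans : ∀ {α β γ} → α < β → β ≤ γ → α < γ
  <-≤-trans α<β (inj₁ β<γ)  = <-trans α<β β<γ
  <-≤-trans α<β (inj₂ refl) = α<β

  ≤-<-trans : ∀ {α β γ} → α ≤ β → β < γ → α < γ
  ≤-<-trans (inj₁ α<β)  β<γ = <-trans α<β β<γ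
  ≤-<-trans (inj₂ refl) β<γ = β<γ

  ≤-trans : ∀ {α β γ} → α ≤ β → β ≤ γ → α ≤ γ
  ≤-trans α≤β (inj₁ β<γ)  = inj₁ (≤-<-trans α≤β β<γ)
  ≤-trans α≤β (inj₂ refl) = α≤β

  <⇒≱ : ∀ {α β} → α < β → ¬ β ≤ α
  <⇒≱ α<β β≤α = <-irrefl refl (<-≤-trans α<β β≤α)

  ≮⇒≥ : ∀ {α β} → ¬ α < β → β ≤ α
  ≮⇒≥ {α} {β} α≮β with compare α β
  ... | tri< α<β _ _ = contradiction α<β α≮β
  ... | tri≈ _ α≡β _ = inj₂ (≡.sym α≡β)
  ... | tri> _ _ β<α = inj₁ β<α

  ≰⇒> : ∀ {α β} → ¬ α ≤ β → β < α
  ≰⇒> {α} {β} α≰β = decidable-stable em (α≰β ∘ ≮⇒≥)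

  α≤max : ∀ α β → α ≤ max α β
  α≤max α β with α <? β
  ... | yes α<β = inj₁ α<β
  ... | no  _   = ≤-refl

  β≤max : ∀ α β → β ≤ max α β
  β≤max α β with α <? β
  ... | yes _  = ≤-refl
  ... | no α≮β = ≮⇒≥ α≮β

  IsLeast : ∀ {p} → Pred Carrier p → Pred Carrier (a ⊔ p)
  IsLeast P α = α ∈ P × (∀ β → β ∈ P → ¬ β < α)

  least : ∀ {p} (P : Pred Carrier p) → ∃[ α ] α ∈ P → ∃[ α ] IsLeast P α
  least P (α , α∈P) = go α (wellFounded α) α∈P
    where
    go : ∀ α → Acc _<_ α → α ∈ P → ∃[ β ] IsLeast P β
    go α (acc rs) α∈P with em {P = ∃[ β ] β < α × β ∈ P}
    ... | yes (β , β<α , β∈P) = go β (rs β<α) β∈P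
    ... | no ¬smaller         = α , α∈P , λ β β∈P β<α → ¬smaller (β , β<α , β∈P)

  IsLeast-unique : ∀ {p q} {P : Pred Carrier p} {Q : Pred Carrier q} {α β} →
                   (∀ {γ} → P γ → Q γ) → (∀ {γ} → Q γ → P γ) →
                   IsLeast P α → IsLeast Q β → α ≡ β
  IsLeast-unique {α = α} {β} P⇒Q Q⇒P (p , minP) (q , minQ) with compare α β
  ... | tri< α<β _ _ = contradiction α<β (minQ α (P⇒Q p))
  ... | tri≈ _ α≡β _ = α≡β
  ... | tri> _ _ β<α = contradiction β<α (minP β (Q⇒P q))

  data Kind (α : Carrier) : Set a where
    isZero      : IsZero α → Kind α
    isSuccessor : ∀ β → IsSuccessorOf α β → Kind α
    isLimit     : IsLimit α → Kind α

  kind : ∀ α → Kind α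
  kind α with em {P = IsZero α}
  ... | yes α≡0 = isZero α≡0
  ... | no  α≢0 with em {P = ∃[ β ] IsSuccessorOf α β}
  ...   | yes (β , α≡β+1) = isSuccessor β α≡β+1
  ...   | no  ¬successor  = isLimit (α≢0 , λ β β<α → decidable-stable em λ ¬between →
            ¬successor (β , β<α , λ γ β<γ γ<α → ¬between (γ , β<γ , γ<α)))

module RegularProperties (em : ∀ {ℓ} → ExcludedMiddle ℓ) {a} (κ : Ordinal a)
                         (κ-regular : IsRegularUncountable κ) where
  open Ordinal κ
  open OrdinalProperties em κ
  open IsRegularUncountable κ-regular

  -- If some β lies below α, `regular` bounds the constant function α on the segment below α.
  -- Otherwise a maximal α would be the only element, and a single element injects into ℕ.
  larger : ∀ α → ∃[ β ] α < β
  larger α with em {P = ∃[ β ] α < β} | em {P = ∃[ β ] β < α}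
  ... | yes above | _ = above
  ... | no  _     | yes (β , β<α) with δ , below ← regular α (λ _ → α) = δ , below β β<α
  ... | no  α-max | no  α-min     = contradiction ((λ _ → 0) , λ {β} {γ} → singleton β γ) uncountable
    where
    ≡α : ∀ β → β ≡ α
    ≡α β with compare β α
    ... | tri< β<α _ _ = contradiction (β , β<α) α-min
    ... | tri≈ _ β≡α _ = β≡α
    ... | tri> _ _ α<β = contradiction (β , α<β) α-max
    singleton : ∀ β γ → 0 ≡ 0 → β ≡ γ
    singleton β γ _ = ≡.trans (≡α β) (≡.sym (≡α γ))

  next : Carrier → Carrier
  next α = proj₁ (least (α <_) (larger α))

  <-next : ∀ α → α < next α
  <-next α = proj₁ (proj₂ (least (α <_) (larger α)))

  next-isSuccessor : ∀ α → IsSuccessorOf (next α) α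
  next-isSuccessor α = proj₂ (least (α <_) (larger α))

  commonBound : ∀ α β → ∃[ γ ] α < γ × β < γ
  commonBound α β = next (max α β) ,
    ≤-<-trans (α≤max α β) (<-next _) , ≤-<-trans (β≤max α β) (<-next _)

  module _ (α₀ : Carrier) where
    private
      zeroth = least (λ _ → α₀ ≡ α₀) (α₀ , refl)

      fromℕ : ℕ → Carrier
      fromℕ ℕ.zero    = proj₁ zeroth
      fromℕ (ℕ.suc n) = next (fromℕ n)

      fromℕ-mono : ∀ {m n} → m ℕ.<′ n → fromℕ m < fromℕ n
      fromℕ-mono (ℕ.<′-base)    = <-next _
      fromℕ-mono (ℕ.≤′-step m<n) = <-trans (fromℕ-mono m<n) (<-next _)

      fromℕ-injective : ∀ {m n} → fromℕ m ≡ fromℕ n → m ≡ n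
      fromℕ-injective {m} {n} eq with ℕ.<-cmp m n
      ... | tri< m<n _ _ = contradiction (fromℕ-mono (ℕ.<⇒<′ m<n)) (<-irrefl eq)
      ... | tri≈ _ m≡n _ = m≡n
      ... | tri> _ _ n<m = contradiction (fromℕ-mono (ℕ.<⇒<′ n<m)) (<-irrefl (≡.sym eq))

      -- `fromℕ` starts at the least element and moves to immediate successors, so nothing slips in
      -- between its values.
      initial : ∀ n α → ¬ fromℕ n < α → ∃[ m ] fromℕ m ≡ α
      initial n α n≮α with compare (fromℕ n) α
      initial n α n≮α | tri< n<α _ _ = contradiction n<α n≮α
      initial n α n≮α | tri≈ _ n≡α _ = n , n≡α
      initial ℕ.zero α _ | tri> _ _ α<0 = contradiction α<0 (proj₂ (proj₂ zeroth) α refl)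
      initial (ℕ.suc n) α _ | tri> _ _ α<n+1 =
        initial n α λ n<α → proj₂ (next-isSuccessor (fromℕ n)) α n<α α<n+1

      -- Without a bound, every element would fail to exceed some value of `fromℕ` and so be a value
      -- itself by `initial`; taking indices would inject κ into ℕ.
      ω : ∃[ δ ] (∀ n → fromℕ n < δ)
      ω = decidable-stable em λ ¬ω →
        let index = λ α →
              let n , n≮α = ¬∀⇒∃¬ em {P = λ n → fromℕ n < α} (λ below → ¬ω (α , below))
              in  initial n α n≮α
        in uncountable (proj₁ ∘ index , λ {α} {β} eq →
             ≡.trans (≡.sym (proj₂ (index α)))
               (≡.trans (≡.cong fromℕ eq) (proj₂ (index β))))

    -- `regular` speaks of functions on a segment of κ, so the sequence f is transported along
    -- `fromℕ` to the segment below the bound `ω`.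
    ℕ-bounded : (f : ℕ → Carrier) → ∃[ δ ] (∀ n → f n < δ)
    ℕ-bounded f = let δ , below = regular (proj₁ ω) f̂ in
      δ , λ n → subst (_< δ) (f̂-fromℕ n) (below (fromℕ n) (proj₂ ω n))
      where
      f̂ : Carrier → Carrier
      f̂ α with em {P = ∃[ n ] fromℕ n ≡ α}
      ... | yes (n , _) = f n
      -- Arbitrary: only the bounds at values of `fromℕ` are used.
      ... | no  _       = α
      f̂-fromℕ : ∀ n → f̂ (fromℕ n) ≡ f n
      f̂-fromℕ n with em {P = ∃[ m ] fromℕ m ≡ fromℕ n}
      ... | yes (m , eq) = ≡.cong f (fromℕ-injective eq)
      ... | no  ¬∃       = contradiction (n , refl) ¬∃

  -- δ is the supremum of α, h α, h (h α), ..., which exists because sequences indexed by ℕ are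
  -- bounded in κ. This closure point serves every proof of unboundedness below.
  limitAbove : (h : Carrier → Carrier) → (∀ α → α < h α) →
               ∀ α → ∃[ δ ] α < δ × IsLimit δ ×
                     (∀ β → β < δ → ∃[ γ ] β < γ × γ < δ × h γ < δ)
  limitAbove h <-h α = δ , above 0 , ((λ δ≡0 → δ≡0 α (above 0)) , closed⇒limit) , closed
    where
    iterate : ℕ → Carrier
    iterate ℕ.zero    = α
    iterate (ℕ.suc n) = h (iterate n)
    sup = least (λ δ → ∀ n → iterate n < δ) (ℕ-bounded α iterate)
    δ = proj₁ sup
    above = proj₁ (proj₂ sup)
    closed : ∀ β → β < δ → ∃[ γ ] β < γ × γ < δ × h γ < δ
    closed β β<δ =
      let n , n≮β = ¬∀⇒∃¬ em {P = λ n → iterate n < β}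
            (λ below → proj₂ (proj₂ sup) β below β<δ)
      -- The n-th iterate is only known to be at least β, so γ is the next one; h γ is then again an
      -- iterate and lies below δ.
      in iterate (ℕ.suc n) , ≤-<-trans (≮⇒≥ n≮β) (<-h _) , above (ℕ.suc n) , above (ℕ.suc (ℕ.suc n))
    closed⇒limit : ∀ β → β < δ → ∃[ γ ] β < γ × γ < δ
    closed⇒limit β β<δ = let γ , β<γ , γ<δ , _ = closed β β<δ in γ , β<γ , γ<δ

  -- A limit closed under h = d ∘ c is at once a limit of points c γ of C and of points d (c γ) of
  -- D, so it belongs to both.
  ∩-isClub : ∀ {p q} {C : Pred Carrier p} {D : Pred Carrier q} →
             IsClub κ C → IsClub κ D → IsClub κ (C ∩ D)
  ∩-isClub {C = C} {D} C-club D-club = record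
    { unbounded = λ α →
        let δ , α<δ , δ-limit , closed = limitAbove h <-h α in
        δ , α<δ ,
        C.closed δ δ-limit (λ β β<δ →
          let γ , β<γ , _ , hγ<δ = closed β β<δ in
          c γ , <-trans β<γ (<-c γ) , <-trans (<-d (c γ)) hγ<δ , c∈C γ) ,
        D.closed δ δ-limit (λ β β<δ →
          let γ , β<γ , _ , hγ<δ = closed β β<δ in
          h γ , <-trans β<γ (<-h γ) , hγ<δ , d∈D (c γ))
    ; closed = λ α α-limit cofinal →
        C.closed α α-limit (λ β β<α →
          let γ , β<γ , γ<α , γ∈C , _ = cofinal β β<α in γ , β<γ , γ<α , γ∈C) ,
        D.closed α α-limit (λ β β<α →
          let γ , β<γ , γ<α , _ , γ∈D = cofinal β β<α in γ , β<γ , γ<α , γ∈D)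
    }
    where
    module C = IsClub C-club
    module D = IsClub D-club
    c d h : Carrier → Carrier
    c α = proj₁ (C.unbounded α)
    d α = proj₁ (D.unbounded α)
    h α = d (c α)
    <-c : ∀ α → α < c α
    <-c α = proj₁ (proj₂ (C.unbounded α))
    <-d : ∀ α → α < d α
    <-d α = proj₁ (proj₂ (D.unbounded α))
    <-h : ∀ α → α < h α
    <-h α = <-trans (<-c α) (<-d (c α))
    c∈C : ∀ α → c α ∈ C
    c∈C α = proj₂ (proj₂ (C.unbounded α))
    d∈D : ∀ α → d α ∈ D
    d∈D α = proj₂ (proj₂ (D.unbounded α))

  ClubEq-trans : ∀ {d e g} {D : Pred Carrier d} {E : Pred Carrier e}
                 {G : Pred Carrier g} →
                 ClubEq κ D E → ClubEq κ E G → ClubEq κ D G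
  ClubEq-trans (C , C-club , D⇔E) (C′ , C′-club , E⇔G) =
    C ∩ C′ , ∩-isClub C-club C′-club , λ α (α∈C , α∈C′) →
    mk⇔ (to (E⇔G α α∈C′) ∘ to (D⇔E α α∈C))
        (from (D⇔E α α∈C) ∘ from (E⇔G α α∈C′))
    where open Equivalence

-- Continuous decreasing chains in bounded lattices

module ChainProperties (em : ∀ {ℓ} → ExcludedMiddle ℓ)
                       {c ℓ₁ ℓ₂} (A : BoundedLattice c ℓ₁ ℓ₂) where
  open BoundedLattice A renaming (refl to ≤-refl; trans to ≤-trans)

  -- A complement z over y′ is enlarged to y ∨ z. The hypothesis y ≤ x is what lets the modular law
  -- turn x ∧ (y ∨ z) into y ∨ (x ∧ z).
  complementedOver-upward : IsModular A → ∀ {x y y′} → y′ ≤ y → y ≤ x →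
                            ComplementedOver A x y′ → ComplementedOver A x y
  complementedOver-upward modular {x} {y} {y′} y′≤y y≤x (z , x∧z≈y′ , x∨z≈⊤) =
    y ∨ z , (begin
      x ∧ (y ∨ z)  ≈⟨ ∧-comm x (y ∨ z) ⟩
      (y ∨ z) ∧ x  ≈⟨ modular y z x y≤x ⟨
      y ∨ (z ∧ x)  ≈⟨ ∨-cong Eq.refl (∧-comm z x) ⟩
      y ∨ (x ∧ z)  ≈⟨ ∨-cong Eq.refl x∧z≈y′ ⟩
      y ∨ y′       ≈⟨ ∨-comm y y′ ⟩
      y′ ∨ y       ≈⟨ x≤y⇒x∨y≈y y′≤y ⟩
      y            ∎) ,
    antisym (maximum _) (≤-trans (reflexive (Eq.sym x∨z≈⊤))
      (∨-least (x≤x∨y x (y ∨ z)) (≤-trans (y≤x∨y y z) (y≤x∨y x (y ∨ z)))))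
    where
    open JoinProperties joinSemilattice using (∨-cong; ∨-comm; x≤y⇒x∨y≈y)
    open MeetProperties meetSemilattice using (∧-comm)
    open SetoidReasoning setoid

  complementedOver-congˡ : ∀ {x x′ y} → x ≈ x′ →
                           ComplementedOver A x y → ComplementedOver A x′ y
  complementedOver-congˡ x≈x′ (z , x∧z≈y , x∨z≈⊤) =
    z , Eq.trans (∧-cong (Eq.sym x≈x′) Eq.refl) x∧z≈y ,
    Eq.trans (∨-cong (Eq.sym x≈x′) Eq.refl) x∨z≈⊤
    where
    open JoinProperties joinSemilattice using (∨-cong)
    open MeetProperties meetSemilattice using (∧-cong)

  module _ {a} {μ : Ordinal a} (U : CDC A μ) where
    open Ordinal μ using (Carrier; _<_; wellFounded) renaming (_≤_ to _≤ᵒ_)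
    open OrdinalProperties em μ using (Kind; isZero; isSuccessor; isLimit; kind; ≮⇒≥)
    open CDC U

    antitone : ∀ {α β} → α ≤ᵒ β → term β ≤ term α
    antitone-< : ∀ {α} β → Acc _<_ β → α < β → term β ≤ term α

    antitone (inj₁ α<β)  = antitone-< _ (wellFounded _) α<β
    antitone (inj₂ refl) = ≤-refl

    antitone-< {α} β (acc rs) α<β with kind β
    ... | isZero β≡0 = contradiction α<β (β≡0 α)
    ... | isLimit β-limit = proj₁ (atLimit β β-limit) α α<β
    ... | isSuccessor γ γ+1≡β@(γ<β , none-between)
          with ≮⇒≥ {γ} {α} (λ γ<α → none-between α γ<α α<β)
    ...   | inj₁ α<γ  = ≤-trans (proj₁ (decreasing γ β γ+1≡β)) (antitone-< γ (rs γ<β) α<γ)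
    ...   | inj₂ refl = proj₁ (decreasing γ β γ+1≡β)

  -- Comparison of two continuous decreasing chains

  module _ {a} {κ : Ordinal a} (κ-regular : IsRegularUncountable κ) where
    private
      module κ where
        open Ordinal κ public
        open OrdinalProperties em κ public
        open RegularProperties em κ κ-regular public

    -- An embedding f : κ → μ is built by recursion, f α being the least strict
    -- upper bound of the f β with β < α.  Were these f β unbounded in μ, then by
    -- regularity of κ some V δ would be below every term of W.

    length-≼ : CDC A κ → ∀ (μ : Ordinal a) → CDC A μ → κ ≼ μ
    length-≼ V μ W = f , f-mono
      where
      module V = CDC V
      module W = CDC W
      module μ where
        open Ordinal μ public
        open OrdinalProperties em μ public

      Bound : ∀ α → (∀ {β} → β κ.< α → μ.Carrier) → Pred μ.Carrier a
      Bound α h γ = ∀ β (β<α : β κ.< α) → h β<α μ.< γ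

      F : ∀ α → (∀ {β} → β κ.< α → μ.Carrier) → μ.Carrier
      F α h with em {P = ∃[ γ ] Bound α h γ}
      ... | yes bounded = proj₁ (μ.least (Bound α h) bounded)
      -- Some element of μ is needed as a default; `bounded` shows that this case never arises for
      -- `f`.
      ... | no  _       = proj₁ (W.cofinal (V.term α) (V.nonzero α))

      -- Unfolding the recursion requires that `F` depend only on the values of the history. The
      -- default value ignores the history, so two unbounded histories agree trivially.
      F-ext : ∀ α {h h′ : ∀ {β} → β κ.< α → μ.Carrier} →
              (∀ {β} (β<α : β κ.< α) → h β<α ≡ h′ β<α) → F α h ≡ F α h′
      F-ext α {h} {h′} h≡h′ with em {P = ∃[ γ ] Bound α h γ} | em {P = ∃[ γ ] Bound α h′ γ}
      ... | no  _  | no  _  = refl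
      ... | yes b  | yes b′ = μ.IsLeast-unique
            (λ bound β β<α → subst (μ._< _) (h≡h′ β<α) (bound β β<α))
            (λ bound β β<α → subst (μ._< _) (≡.sym (h≡h′ β<α)) (bound β β<α))
            (proj₂ (μ.least (Bound α h) b)) (proj₂ (μ.least (Bound α h′) b′))
      ... | yes (γ , b) | no ¬b = contradiction
            (γ , λ β β<α → subst (μ._< γ) (h≡h′ β<α) (b β β<α)) ¬b
      ... | no ¬b | yes (γ , b) = contradiction
            (γ , λ β β<α → subst (μ._< γ) (≡.sym (h≡h′ β<α)) (b β β<α)) ¬b

      module Rec = FixPoint κ.wellFounded (λ _ → μ.Carrier) F F-ext

      f : κ.Carrier → μ.Carrier
      f = All.wfRec κ.wellFounded a (λ _ → μ.Carrier) F

      bounded : ∀ α → ∃[ γ ] (∀ β → β κ.< α → f β μ.< γ)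
      bounded α = decidable-stable em λ unbounded →
        let g = λ γ → V.cofinal (W.term γ) (W.nonzero γ)
            δ , g∘f<δ = κ-regular .IsRegularUncountable.regular α (proj₁ ∘ g ∘ f)
            Vδ≤W = λ γ →
              let β , β≮  = ¬∀⇒∃¬ em {P = λ β → β κ.< α → f β μ.< γ}
                              (λ all → unbounded (γ , all))
                  β<α , γ≤fβ = dichotomy β≮
              in ≤-trans (antitone V (inj₁ (g∘f<δ β β<α)))
                 (≤-trans (proj₂ (g (f β))) (antitone W γ≤fβ))
            -- `V.term δ+1` is non-zero, so it lies above some term of W and hence above `V.term δ`,
            -- against strict decrease.
            δ+1 = κ.next δ
            γ , Wγ≤Vδ+1 = W.cofinal (V.term δ+1) (V.nonzero δ+1)
            Vδ+1≤Vδ , Vδ+1≉Vδ = V.decreasing δ δ+1 (κ.next-isSuccessor δ)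
        in Vδ+1≉Vδ (antisym Vδ+1≤Vδ (≤-trans (Vδ≤W γ) Wγ≤Vδ+1))
        where
        dichotomy : ∀ {β γ} → ¬ (β κ.< α → f β μ.< γ) → β κ.< α × γ μ.≤ f β
        dichotomy ¬imp =
          decidable-stable em (λ β≮α → ¬imp (λ β<α → contradiction β<α β≮α)) ,
          μ.≮⇒≥ (λ fβ<γ → ¬imp (λ _ → fβ<γ))

      F-bound : ∀ α (h : ∀ {β} → β κ.< α → μ.Carrier) → ∃[ γ ] Bound α h γ →
                Bound α h (F α h)
      F-bound α h b with em {P = ∃[ γ ] Bound α h γ}
      ... | yes b′ = proj₁ (proj₂ (μ.least (Bound α h) b′))
      ... | no  ¬b = contradiction b ¬b

      f-mono : ∀ β α → β κ.< α → f β μ.< f α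
      f-mono β α β<α = subst (f β μ.<_) (≡.sym Rec.unfold-wfRec)
        (F-bound α (λ {β} _ → f β) (bounded α) β β<α)

    -- By cofinality V has a term below `U.term β`, taken at an index beyond α. A complement over
    -- that term would be carried up to `U.term β` by `complementedOver-upward`.
    exceptional-agree : IsModular A → (U V : CDC A κ) → ∀ {α} →
      CDC.term U α ≈ CDC.term V α → exceptional A U α → exceptional A V α
    exceptional-agree modular U V {α} Uα≈Vα (β , α<β , ¬complemented) =
      let γ , Vγ≤Uβ     = V.cofinal (U.term β) (U.nonzero β)
          γ′ , α<γ′ , γ<γ′ = κ.commonBound α γ
      in γ′ , α<γ′ , λ complemented → ¬complemented
           (complementedOver-upward modular
             (≤-trans (antitone V (inj₁ γ<γ′)) Vγ≤Uβ)
             (antitone U (inj₁ α<β))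
             (complementedOver-congˡ (Eq.sym Uα≈Vα) complemented))
      where
      module U = CDC U
      module V = CDC V

  -- The function h jumps so far that each chain at h α is below the other at α. At a limit closed
  -- under h the two chains interleave, so their meets coincide. Closedness is the same argument
  -- with interleaving replaced by equality at cofinally many points.
  agreement-isClub : ∀ {a} {κ : Ordinal a} → IsRegularUncountable κ →
    (U V : CDC A κ) → IsClub κ (λ α → CDC.term U α ≈ CDC.term V α)
  agreement-isClub {κ = κ} κ-regular U V = record
    { unbounded = λ α →
        let δ , α<δ , δ-limit , closed = limitAbove h <-h α in
        δ , α<δ , antisym
          (proj₂ (V.atLimit δ δ-limit) _ λ β β<δ →
            let γ , β<γ , _ , hγ<δ = closed β β<δ in
            ≤-trans (antitone U (inj₁ hγ<δ)) (≤-trans (Uh≤V γ) (antitone V (inj₁ β<γ))))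
          (proj₂ (U.atLimit δ δ-limit) _ λ β β<δ →
            let γ , β<γ , _ , hγ<δ = closed β β<δ in
            ≤-trans (antitone V (inj₁ hγ<δ)) (≤-trans (Vh≤U γ) (antitone U (inj₁ β<γ))))
    ; closed = λ α α-limit cofinal → antisym
        (proj₂ (V.atLimit α α-limit) _ λ β β<α →
          let γ , β<γ , γ<α , Uγ≈Vγ = cofinal β β<α in
          ≤-trans (antitone U (inj₁ γ<α))
            (≤-trans (reflexive Uγ≈Vγ) (antitone V (inj₁ β<γ))))
        (proj₂ (U.atLimit α α-limit) _ λ β β<α →
          let γ , β<γ , γ<α , Uγ≈Vγ = cofinal β β<α in
          ≤-trans (antitone V (inj₁ γ<α))
            (≤-trans (reflexive (Eq.sym Uγ≈Vγ)) (antitone U (inj₁ β<γ))))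
    }
    where
    open Ordinal κ using (_<_) renaming (Carrier to K)
    open OrdinalProperties em κ using (<-trans)
    open RegularProperties em κ κ-regular
    module U = CDC U
    module V = CDC V
    beyond : ∀ α → ∃[ δ ] α < δ × U.term δ ≤ V.term α × V.term δ ≤ U.term α
    beyond α =
      let β , Uβ≤Vα = U.cofinal (V.term α) (V.nonzero α)
          γ , Vγ≤Uα = V.cofinal (U.term α) (U.nonzero α)
          δ , α<δ , β<δ = commonBound α β
          ε , δ<ε , γ<ε = commonBound δ γ
      in ε , <-trans α<δ δ<ε ,
         ≤-trans (antitone U (inj₁ (<-trans β<δ δ<ε))) Uβ≤Vα ,
         ≤-trans (antitone V (inj₁ γ<ε)) Vγ≤Uα
    h : K → K
    h α = proj₁ (beyond α)
    <-h : ∀ α → α < h α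
    <-h α = proj₁ (proj₂ (beyond α))
    Uh≤V : ∀ α → U.term (h α) ≤ V.term α
    Uh≤V α = proj₁ (proj₂ (proj₂ (beyond α)))
    Vh≤U : ∀ α → V.term (h α) ≤ U.term α
    Vh≤U α = proj₂ (proj₂ (proj₂ (beyond α)))

Γ-independent : (∀ {ℓ} → ExcludedMiddle ℓ) →
  ∀ {a c ℓ₂} (A : BoundedLattice c a ℓ₂) → IsModular A →
  (κ : Ordinal a) → IsRegularUncountable κ → (U V : CDC A κ) →
  ClubEq κ (exceptional A U) (exceptional A V)
Γ-independent em A modular κ κ-regular U V =
  _ , agreement-isClub κ-regular U V , λ α Uα≈Vα →
  mk⇔ (exceptional-agree κ-regular modular U V Uα≈Vα)
      (exceptional-agree κ-regular modular V U (BoundedLattice.Eq.sym A Uα≈Vα))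
  where open ChainProperties em A

-- Submodules and free modules

module Submodules {a} (F : CommutativeRing a a)
                  (M : LeftModule (CommutativeRing.ring F) a a) where
  open CommutativeRing F using (-_; 1#; -‿inverseˡ) renaming (_≈_ to _≈ᴷ_)
  private module F = CommutativeRing F
  open LeftModule M
  open AbelianGroupProperties +ᴹ-abelianGroup using (inverseˡ-unique)
  open CommutativeSemigroupProperties
    (CommutativeMonoid.commutativeSemigroup
      (AbelianGroup.commutativeMonoid +ᴹ-abelianGroup))
    using (interchange)
  open Endomorphisms F M renaming
    ( respects to ≈ᴱ-closed ; 0∈ to 0ᴱ∈ ; 1∈ to 1ᴱ∈ ; +-closed to +ᴱ-closed
    ; neg-closed to -ᴱ-closed ; *-closed to *ᴱ-closed ; ·-closed to ·ᴱ-closed)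
  open End

  record IsSubmodule {p} (N : Pred Carrierᴹ p) : Set (a ⊔ p) where
    field
      respects : ∀ v w → v ≈ᴹ w → v ∈ N → w ∈ N
      0∈       : 0ᴹ ∈ N
      +-closed : ∀ v w → v ∈ N → w ∈ N → v +ᴹ w ∈ N
      *-closed : ∀ c v → v ∈ N → c *ₗ v ∈ N

    neg-closed : ∀ v → v ∈ N → -ᴹ v ∈ N
    neg-closed v v∈N = respects _ _ (inverseˡ-unique _ _ -1v+v≈0) (*-closed (- 1#) v v∈N)
      where
      open SetoidReasoning ≈ᴹ-setoid
      -1v+v≈0 : (- 1#) *ₗ v +ᴹ v ≈ᴹ 0ᴹ
      -1v+v≈0 = begin
        (- 1#) *ₗ v +ᴹ v         ≈⟨ +ᴹ-congˡ (*ₗ-identityˡ v) ⟨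
        (- 1#) *ₗ v +ᴹ 1# *ₗ v   ≈⟨ *ₗ-distribʳ v (- 1#) 1# ⟨
        (- 1# F.+ 1#) *ₗ v       ≈⟨ *ₗ-congʳ (-‿inverseˡ 1#) ⟩
        F.0# *ₗ v                ≈⟨ *ₗ-zeroˡ v ⟩
        0ᴹ                       ∎

  preimage : ∀ {p} {N : Pred Carrierᴹ p} → IsSubmodule N → (t : End) →
             IsSubmodule (λ v → v ▷ t ∈ N)
  preimage N-sub t = record
    { respects = λ v w v≈w → respects _ _ (apply-cong t v≈w)
    ; 0∈       = respects _ _ (≈ᴹ-sym (0ᴹ-homo t)) 0∈
    ; +-closed = λ v w p q → respects _ _ (≈ᴹ-sym (+ᴹ-homo t v w)) (+-closed _ _ p q)
    ; *-closed = λ c v p → respects _ _ (≈ᴹ-sym (*ₗ-homo t c v)) (*-closed c _ p)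
    }
    where open IsSubmodule N-sub

  zeroSubmodule : IsSubmodule (_≈ᴹ 0ᴹ)
  zeroSubmodule = record
    { respects = λ v w v≈w v≈0 → ≈ᴹ-trans (≈ᴹ-sym v≈w) v≈0
    ; 0∈       = ≈ᴹ-refl
    ; +-closed = λ v w v≈0 w≈0 → ≈ᴹ-trans (+ᴹ-cong v≈0 w≈0) (+ᴹ-identityˡ 0ᴹ)
    ; *-closed = λ c v v≈0 → ≈ᴹ-trans (*ₗ-congˡ v≈0) (*ₗ-zeroʳ c)
    }

  equalizer : (t u : End) → IsSubmodule (λ v → v ▷ t ≈ᴹ v ▷ u)
  equalizer t u = record
    { respects = λ v w v≈w eq → ≈ᴹ-trans (apply-cong t (≈ᴹ-sym v≈w)) (≈ᴹ-trans eq (apply-cong u v≈w))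
    ; 0∈       = ≈ᴹ-trans (0ᴹ-homo t) (≈ᴹ-sym (0ᴹ-homo u))
    ; +-closed = λ v w p q → ≈ᴹ-trans (+ᴹ-homo t v w)
                   (≈ᴹ-trans (+ᴹ-cong p q) (≈ᴹ-sym (+ᴹ-homo u v w)))
    ; *-closed = λ c v p → ≈ᴹ-trans (*ₗ-homo t c v)
                   (≈ᴹ-trans (*ₗ-congˡ p) (≈ᴹ-sym (*ₗ-homo u c v)))
    }

  Invariant : ∀ {p} → Pred Carrierᴹ p → Pred End _
  Invariant N t = ∀ v → v ∈ N → v ▷ t ∈ N

  -- The endomorphisms preserving a submodule form a unital subalgebra, so only generators need to
  -- be tested.
  generated-invariant : ∀ {p} {N : Pred Carrierᴹ p} → IsSubmodule N →
    ∀ {G} → G ⊆ Invariant N → Generated G ⊆ Invariant N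
  generated-invariant {N = N} N-sub {G} G-inv = go
    where
    module N = IsSubmodule N-sub
    go : Generated G ⊆ Invariant N
    go (generator t∈G) v v∈N = G-inv t∈G v v∈N
    go (≈ᴱ-closed t≈u t∈) v v∈N = N.respects _ _ (t≈u v) (go t∈ v v∈N)
    go 0ᴱ∈ v v∈N = N.0∈
    go 1ᴱ∈ v v∈N = v∈N
    go (+ᴱ-closed t∈ u∈) v v∈N = N.+-closed _ _ (go t∈ v v∈N) (go u∈ v v∈N)
    go (-ᴱ-closed t∈) v v∈N = N.neg-closed _ (go t∈ v v∈N)
    go (*ᴱ-closed t∈ u∈) v v∈N = go u∈ _ (go t∈ v v∈N)
    go (·ᴱ-closed c t∈) v v∈N = N.*-closed c _ (go t∈ v v∈N)

  difference : ∀ v w → v +ᴹ w +ᴹ -ᴹ w ≈ᴹ v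
  difference v w = ≈ᴹ-trans (+ᴹ-assoc v w (-ᴹ w))
    (≈ᴹ-trans (+ᴹ-congˡ (-ᴹ‿inverseʳ w)) (+ᴹ-identityʳ v))

  difference-+ : ∀ v w → v +ᴹ -ᴹ w +ᴹ w ≈ᴹ v
  difference-+ v w = ≈ᴹ-trans (+ᴹ-assoc v (-ᴹ w) w)
    (≈ᴹ-trans (+ᴹ-congˡ (-ᴹ‿inverseˡ w)) (+ᴹ-identityʳ v))

  *ₗ-cancel : ∀ {p} {N : Pred Carrierᴹ p} → IsSubmodule N →
              ∀ {c d} → c F.* d F.≈ 1# → ∀ v → c *ₗ v ∈ N → v ∈ N
  *ₗ-cancel N-sub {c} {d} cd≈1 v cv∈N = IsSubmodule.respects N-sub _ _
    (≈ᴹ-trans (≈ᴹ-sym (*ₗ-assoc d c v))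
      (≈ᴹ-trans (*ₗ-congʳ (F.trans (F.*-comm d c) cd≈1)) (*ₗ-identityˡ v)))
    (IsSubmodule.*-closed N-sub d _ cv∈N)

  -- The upper right entries in the laws of the ring of matrices (f l; 0 r).

  row-cong : ∀ {f g l m k n} (r s : End) → f ≈ᴷ g → k ≈ᴹ n → l ≈ᴹ m → r ≈ᴱ s →
             f *ₗ k +ᴹ l ▷ r ≈ᴹ g *ₗ n +ᴹ m ▷ s
  row-cong {m = m} r s f≈g k≈n l≈m r≈s =
    +ᴹ-cong (*ₗ-cong f≈g k≈n) (≈ᴹ-trans (apply-cong r l≈m) (r≈s m))

  row-assoc : ∀ f g k l m (r s : End) →
    (f F.* g) *ₗ m +ᴹ (f *ₗ l +ᴹ k ▷ r) ▷ s ≈ᴹ f *ₗ (g *ₗ m +ᴹ l ▷ s) +ᴹ k ▷ r ▷ s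
  row-assoc f g k l m r s = begin
    (f F.* g) *ₗ m +ᴹ (f *ₗ l +ᴹ k ▷ r) ▷ s
      ≈⟨ +ᴹ-cong (*ₗ-assoc f g m) (+ᴹ-homo s _ _) ⟩
    f *ₗ g *ₗ m +ᴹ ((f *ₗ l) ▷ s +ᴹ k ▷ r ▷ s)
      ≈⟨ +ᴹ-congˡ (+ᴹ-congʳ (*ₗ-homo s f l)) ⟩
    f *ₗ g *ₗ m +ᴹ (f *ₗ (l ▷ s) +ᴹ k ▷ r ▷ s)
      ≈⟨ +ᴹ-assoc _ _ _ ⟨
    f *ₗ g *ₗ m +ᴹ f *ₗ (l ▷ s) +ᴹ k ▷ r ▷ s
      ≈⟨ +ᴹ-congʳ (*ₗ-distribˡ f _ _) ⟨
    f *ₗ (g *ₗ m +ᴹ l ▷ s) +ᴹ k ▷ r ▷ s ∎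
    where open SetoidReasoning ≈ᴹ-setoid

  row-identityˡ : ∀ l r → 1# *ₗ l +ᴹ 0ᴹ ▷ r ≈ᴹ l
  row-identityˡ l r =
    ≈ᴹ-trans (+ᴹ-cong (*ₗ-identityˡ l) (0ᴹ-homo r)) (+ᴹ-identityʳ l)

  row-identityʳ : ∀ f l → f *ₗ 0ᴹ +ᴹ l ≈ᴹ l
  row-identityʳ f l = ≈ᴹ-trans (+ᴹ-congʳ (*ₗ-zeroʳ f)) (+ᴹ-identityˡ l)

  row-distribˡ : ∀ f k l m (r s : End) →
    f *ₗ (l +ᴹ m) +ᴹ (k ▷ r +ᴹ k ▷ s) ≈ᴹ (f *ₗ l +ᴹ k ▷ r) +ᴹ (f *ₗ m +ᴹ k ▷ s)
  row-distribˡ f k l m r s =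
    ≈ᴹ-trans (+ᴹ-congʳ (*ₗ-distribˡ f l m)) (interchange _ _ _ _)

  row-distribʳ : ∀ f g k l m (r : End) →
    (f F.+ g) *ₗ k +ᴹ (l +ᴹ m) ▷ r ≈ᴹ (f *ₗ k +ᴹ l ▷ r) +ᴹ (g *ₗ k +ᴹ m ▷ r)
  row-distribʳ f g k l m r =
    ≈ᴹ-trans (+ᴹ-cong (*ₗ-distribʳ k f g) (+ᴹ-homo r l m)) (interchange _ _ _ _)

  row-·-assoc : ∀ c f k l (r : End) →
    (c F.* f) *ₗ l +ᴹ (c *ₗ k) ▷ r ≈ᴹ c *ₗ (f *ₗ l +ᴹ k ▷ r)
  row-·-assoc c f k l r =
    ≈ᴹ-trans (+ᴹ-cong (*ₗ-assoc c f l) (*ₗ-homo r c k)) (≈ᴹ-sym (*ₗ-distribˡ c _ _))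

  *ₗ-swap : ∀ c d v → c *ₗ d *ₗ v ≈ᴹ d *ₗ c *ₗ v
  *ₗ-swap c d v = ≈ᴹ-trans (≈ᴹ-sym (*ₗ-assoc c d v))
    (≈ᴹ-trans (*ₗ-congʳ (F.*-comm c d)) (*ₗ-assoc d c v))

  row-·-comm : ∀ c f k l → f *ₗ c *ₗ l +ᴹ c *ₗ k ≈ᴹ c *ₗ (f *ₗ l +ᴹ k)
  row-·-comm c f k l =
    ≈ᴹ-trans (+ᴹ-congʳ (*ₗ-swap f c l)) (≈ᴹ-sym (*ₗ-distribˡ c _ _))

-- Supports and spans in a free module

module FreeProperties (em : ∀ {ℓ} → ExcludedMiddle ℓ) {a}
                      (F : CommutativeRing a a) (Y : DecSetoid a a) where
  private module Y = DecSetoid Y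
  open CommutativeRing F hiding (refl)
  private
    refl′ : ∀ {x} → x ≈ x
    refl′ = CommutativeRing.refl F
  open Free F Y
  open RingProperties ring using (-0#≈0#)
  open Submodules F leftModule

  Extensional : ∀ {q} → Pred Y.Carrier q → Set _
  Extensional Q = ∀ y z → y Y.≈ z → Q y → Q z

  -- This is the span of the basis vectors in Q. Describing it by coefficients makes it independent
  -- of the list that represents a combination.
  Supported : ∀ {q} → Pred Y.Carrier q → Pred Combination _
  Supported Q v = ∀ y → ¬ Q y → coeff v y ≈ 0#

  supported-isSubmodule : ∀ {q} (Q : Pred Y.Carrier q) → IsSubmodule (Supported Q)
  supported-isSubmodule Q = record
    { respects = λ v w v≈w v∈ y ¬q → trans (sym (v≈w y)) (v∈ y ¬q)
    ; 0∈       = λ y ¬q → refl′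
    ; +-closed = λ v w v∈ w∈ y ¬q → trans (coeff-++ v w y)
                   (trans (+-cong (v∈ y ¬q) (w∈ y ¬q)) (+-identityˡ 0#))
    ; *-closed = λ c v v∈ y ¬q → trans (coeff-scale c v y)
                   (trans (*-congˡ (v∈ y ¬q)) (zeroʳ c))
    }

  coeff-basis-self : ∀ y z → y Y.≈ z → coeff (basis y) z ≈ 1#
  coeff-basis-self y z y≈z with y Y.≟ z
  ... | yes _  = +-identityʳ 1#
  ... | no y≉z = contradiction y≈z y≉z

  coeff-basis-other : ∀ y z → ¬ y Y.≈ z → coeff (basis y) z ≈ 0#
  coeff-basis-other y z y≉z with y Y.≟ z
  ... | yes y≈z = contradiction y≈z y≉z
  ... | no _    = +-identityˡ 0#

  coeff-cong : ∀ v {y z} → y Y.≈ z → coeff v y ≈ coeff v z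
  coeff-cong [] y≈z = refl′
  coeff-cong ((c , x) ∷ v) {y} {z} y≈z with x Y.≟ y | x Y.≟ z
  ... | yes _   | yes _   = +-congˡ (coeff-cong v y≈z)
  ... | no  _   | no  _   = +-congˡ (coeff-cong v y≈z)
  ... | yes x≈y | no  x≉z = contradiction (Y.trans x≈y y≈z) x≉z
  ... | no  x≉y | yes x≈z = contradiction (Y.trans x≈z (Y.sym y≈z)) x≉y

  Remaining : Combination → Y.Carrier → Pred Y.Carrier _
  Remaining v y z = ¬ y Y.≈ z × ¬ coeff v z ≈ 0#

  remaining-extensional : ∀ v y → Extensional (Remaining v y)
  remaining-extensional v y x z x≈z (y≉x , vx≉0) =
    (λ y≈z → y≉x (Y.trans y≈z (Y.sym x≈z))) ,
    λ vz≈0 → vx≉0 (trans (coeff-cong v x≈z) vz≈0)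

  minus-term : ∀ v y → v ++ neg (scale (coeff v y) (basis y)) ∈ Supported (Remaining v y)
  minus-term v y z ¬remaining = trans (coeff-++ v _ z)
    (trans (+-congˡ (trans (coeff-neg (scale c (basis y)) z)
                           (-‿cong (coeff-scale c (basis y) z)))) cancels)
    where
    c = coeff v y
    cancels : coeff v z - c * coeff (basis y) z ≈ 0#
    cancels with y Y.≟ z
    ... | yes y≈z = trans (+-cong (sym (coeff-cong v y≈z))
            (-‿cong (trans (*-congˡ (+-identityʳ 1#)) (*-identityʳ c)))) (-‿inverseʳ c)
    ... | no y≉z = trans (+-cong (decidable-stable em λ vz≉0 → ¬remaining (y≉z , vz≉0))
            (trans (-‿cong (trans (*-congˡ (+-identityʳ 0#)) (zeroʳ c))) -0#≈0#)) (+-identityʳ 0#)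

  basis-supported : ∀ {q} (Q : Pred Y.Carrier q) → Extensional Q →
                    ∀ y → Q y → Supported Q (basis y)
  basis-supported Q ext y q z ¬q = coeff-basis-other y z λ y≈z → ¬q (ext y z y≈z q)

  supported-basis : ¬ 1# ≈ 0# → ∀ {q} (Q : Pred Y.Carrier q) y →
                    Supported Q (basis y) → Q y
  supported-basis 1≉0 Q y y∈ = decidable-stable em λ ¬q →
    1≉0 (trans (sym (coeff-basis-self y y Y.refl)) (y∈ y ¬q))

  supported-span : ∀ {q p} (Q : Pred Y.Carrier q) → Extensional Q →
    {N : Pred Combination p} → IsSubmodule N → (∀ y → Q y → basis y ∈ N) →
    ∀ v → v ∈ Supported Q → v ∈ N
  supported-span Q ext {N} N-sub basis∈N v v∈ =
    N.respects (restrict v) v (coeff-restrict v v∈) (restrict∈N v)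
    where
    module N = IsSubmodule N-sub

    restrict : Combination → Combination
    restrict [] = []
    restrict ((c , y) ∷ w) with em {P = Q y}
    ... | yes _ = (c , y) ∷ restrict w
    ... | no  _ = restrict w

    restrict∈N : ∀ w → restrict w ∈ N
    restrict∈N [] = N.0∈
    restrict∈N ((c , y) ∷ w) with em {P = Q y}
    ... | yes q = N.respects (scale c (basis y) ++ restrict w) ((c , y) ∷ restrict w)
                    (λ z → +-congʳ (if-cong z))
                    (N.+-closed _ _ (N.*-closed c _ (basis∈N y q)) (restrict∈N w))
      where
      if-cong : ∀ z → (if does (y Y.≟ z) then c * 1# else 0#) ≈
                      (if does (y Y.≟ z) then c else 0#)
      if-cong z with y Y.≟ z
      ... | yes _ = *-identityʳ c
      ... | no  _ = refl′
    ... | no  _ = restrict∈N w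

    restrict-inside : ∀ {z} → Q z → ∀ w → coeff (restrict w) z ≈ coeff w z
    restrict-inside q [] = refl′
    restrict-inside {z} q ((c , y) ∷ w) with em {P = Q y}
    ... | yes _ = +-congˡ (restrict-inside q w)
    ... | no ¬q with y Y.≟ z
    ...   | yes y≈z = contradiction (ext z y (Y.sym y≈z) q) ¬q
    ...   | no  _   = trans (restrict-inside q w) (sym (+-identityˡ _))

    restrict-outside : ∀ {z} → ¬ Q z → ∀ w → coeff (restrict w) z ≈ 0#
    restrict-outside ¬q [] = refl′
    restrict-outside {z} ¬q ((c , y) ∷ w) with em {P = Q y}
    ... | no  _ = restrict-outside ¬q w
    ... | yes q with y Y.≟ z
    ...   | yes y≈z = contradiction (ext y z y≈z q) ¬q
    ...   | no  _   = trans (+-identityˡ _) (restrict-outside ¬q w)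

    coeff-restrict : ∀ w → w ∈ Supported Q → restrict w ≈ᶜ w
    coeff-restrict w w∈ z with em {P = Q z}
    ... | yes q  = restrict-inside q w
    ... | no  ¬q = trans (restrict-outside ¬q w) (sym (w∈ z ¬q))

  basis-span : ∀ {p} {N : Pred Combination p} → IsSubmodule N →
               (∀ y → basis y ∈ N) → ∀ v → v ∈ N
  basis-span N-sub basis∈N v = supported-span (λ y → y Y.≈ y)
    (λ _ _ _ _ → Y.refl) N-sub (λ y _ → basis∈N y) v λ y ¬refl → contradiction Y.refl ¬refl

  -- Any ℕ-valued rank is bounded on the finite support of a combination.

  maximal-coefficient : (rank : Y.Carrier → ℕ) → (∀ y z → y Y.≈ z → rank y ℕ.≤ rank z) →
    ∀ v → ¬ v ≈ᶜ [] →
    ∃[ y ] ¬ coeff v y ≈ 0# × (∀ z → rank y ℕ.< rank z → coeff v z ≈ 0#)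
  maximal-coefficient rank rank-resp v v≉0 =
    climb (bound v) (¬∀⇒∃¬ em v≉0) (above-bound v)
    where
    bound : Combination → ℕ
    bound []            = 0
    bound ((_ , y) ∷ w) = rank y ℕ.⊔ bound w

    above-bound : ∀ w z → bound w ℕ.< rank z → coeff w z ≈ 0#
    above-bound [] z _ = refl′
    above-bound ((c , y) ∷ w) z b<z with y Y.≟ z
    ... | yes y≈z = contradiction (rank-resp z y (Y.sym y≈z))
                      (ℕ.<⇒≱ (ℕ.m⊔n<o⇒m<o (rank y) (bound w) b<z))
    ... | no  _   = trans (+-identityˡ _)
                      (above-bound w z (ℕ.m⊔n<o⇒n<o (rank y) (bound w) b<z))

    -- The recursion lowers n, an upper bound for the ranks in the support. A support element whose
    -- rank exceeds the lowered bound attains the previous one and is therefore maximal.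
    climb : ∀ n → ∃[ y ] ¬ coeff v y ≈ 0# →
            (∀ z → n ℕ.< rank z → coeff v z ≈ 0#) →
            ∃[ y ] ¬ coeff v y ≈ 0# × (∀ z → rank y ℕ.< rank z → coeff v z ≈ 0#)
    climb ℕ.zero (y , vy≉0) above =
      y , vy≉0 , λ z y<z → above z (ℕ.≤-<-trans ℕ.z≤n y<z)
    climb (ℕ.suc n) nonzero above
      with em {P = ∃[ y ] ¬ coeff v y ≈ 0# × n ℕ.< rank y}
    ... | yes (y , vy≉0 , n<y) =
      y , vy≉0 , λ z y<z → above z (ℕ.≤-<-trans n<y y<z)
    ... | no ¬top = climb n nonzero λ z n<z → decidable-stable em λ vz≉0 →
                      ¬top (z , vz≉0 , n<z)

  module _ (g : Func Y.setoid (LeftModule.≈ᴹ-setoid leftModule)) where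
    open Extension leftModule g

    extend-basis : ∀ y → extend (basis y) ≈ᶜ Func.to g y
    extend-basis y z = trans (coeff-++ (scale 1# (Func.to g y)) [] z)
      (trans (+-identityʳ _) (trans (coeff-scale 1# (Func.to g y) z) (*-identityˡ _)))

-- The triangular algebra

-- Dedekind's argument: if x = y + z lies in M and y lies in J ≤ M, then z = -y + x lies in M as
-- well.
idealInterval-modular : ∀ {a} (S : Ring a a) (I : Pred (Ring.Carrier S) a)
  (isI : IsTwoSidedIdeal (Ring.rawRing S) I) → IsModular (idealInterval S I isI)
idealInterval-modular S I isI J K M J≤M =
  (λ (y , z , j , (k , m) , x≈y+z) →
    (y , z , j , k , x≈y+z) , M.respects (sym x≈y+z) (M.+-closed (J≤M j) m)) ,
  (λ ((y , z , j , k , x≈y+z) , m) →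
    y , z , j ,
    (k , M.respects (-y+x≈z x≈y+z) (M.+-closed (M.neg-closed (J≤M j)) m)) , x≈y+z)
  where
  open Ring S
  module M = IdealBelow M
  -y+x≈z : ∀ {x y z} → x ≈ y + z → - y + x ≈ z
  -y+x≈z {x} {y} {z} x≈y+z = trans (+-congˡ x≈y+z)
    (trans (sym (+-assoc _ _ _)) (trans (+-congʳ (-‿inverseˡ y)) (+-identityˡ z)))

module TriangularAlgebra {a} (F : CommutativeRing a a) (κ : Ordinal a)
                         (W : Pred (Ordinal.Carrier κ) a) where
  open Construction F κ W
  open Endomorphisms F L using (_▷_; End; 0ᴱ; _≈ᴱ_; 0∈)
  open Submodules F L
  private
    module F = CommutativeRing F
    module L = LeftModule L
    module S = RawRing S

  S-isRing : IsRing S._≈_ S._+_ S._*_ (S.-_) S.0# S.1#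
  S-isRing = record
    { +-isAbelianGroup = record
      { isGroup = record
        { isMonoid = record
          { isSemigroup = record
            { isMagma = record
              { isEquivalence = record
                { refl  = F.refl , (λ _ → F.refl) , λ _ _ → F.refl
                ; sym   = λ (p , q , r) →
                    F.sym p , (λ y → F.sym (q y)) , λ v y → F.sym (r v y)
                ; trans = λ (p , q , r) (p′ , q′ , r′) →
                    F.trans p p′ , (λ y → F.trans (q y) (q′ y)) ,
                    λ v y → F.trans (r v y) (r′ v y)
                }
              ; ∙-cong = λ {x} {x′} {y} {y′} (p , q , r) (p′ , q′ , r′) →
                  F.+-cong p p′ ,
                  L.+ᴹ-cong {Matrix.l x} {Matrix.l x′} {Matrix.l y} {Matrix.l y′} q q′ ,
                  λ v → L.+ᴹ-cong {v ▷ Matrix.r x} {v ▷ Matrix.r x′}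
                                  {v ▷ Matrix.r y} {v ▷ Matrix.r y′} (r v) (r′ v)
              }
            ; assoc = λ (matrix f k r _) (matrix g l s _) (matrix h m t _) →
                F.+-assoc f g h , L.+ᴹ-assoc k l m ,
                λ v → L.+ᴹ-assoc (v ▷ r) (v ▷ s) (v ▷ t)
            }
          ; identity =
              (λ (matrix f l r _) →
                F.+-identityˡ f , L.+ᴹ-identityˡ l , λ v → L.+ᴹ-identityˡ (v ▷ r)) ,
              (λ (matrix f l r _) →
                F.+-identityʳ f , L.+ᴹ-identityʳ l , λ v → L.+ᴹ-identityʳ (v ▷ r))
          }
        ; inverse =
            (λ (matrix f l r _) →
              F.-‿inverseˡ f , L.-ᴹ‿inverseˡ l , λ v → L.-ᴹ‿inverseˡ (v ▷ r)) ,
            (λ (matrix f l r _) →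
              F.-‿inverseʳ f , L.-ᴹ‿inverseʳ l , λ v → L.-ᴹ‿inverseʳ (v ▷ r))
        ; ⁻¹-cong = λ {x} {y} (p , q , r) →
            F.-‿cong p , L.-ᴹ‿cong {Matrix.l x} {Matrix.l y} q ,
            λ v → L.-ᴹ‿cong {v ▷ Matrix.r x} {v ▷ Matrix.r y} (r v)
        }
      ; comm = λ (matrix f l r _) (matrix g m s _) →
          F.+-comm f g , L.+ᴹ-comm l m , λ v → L.+ᴹ-comm (v ▷ r) (v ▷ s)
      }
    ; *-cong = λ {x} {x′} {y} {y′} (p , q , r) (p′ , q′ , r′) →
        F.*-cong p p′ ,
        row-cong {l = Matrix.l x} {m = Matrix.l x′} {k = Matrix.l y} {n = Matrix.l y′}
          (Matrix.r y) (Matrix.r y′) p q′ q r′ ,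
        λ v z → F.trans (End.apply-cong (Matrix.r y) {v ▷ Matrix.r x} {v ▷ Matrix.r x′}
                           (r v) z)
                        (r′ (v ▷ Matrix.r x′) z)
    ; *-assoc = λ (matrix f k r _) (matrix g l s _) (matrix h m t _) →
        F.*-assoc f g h , row-assoc f g k l m s t , λ _ _ → F.refl
    ; *-identity =
        (λ (matrix f l r _) → F.*-identityˡ f , row-identityˡ l r , λ _ _ → F.refl) ,
        (λ (matrix f l r _) → F.*-identityʳ f , row-identityʳ f l , λ _ _ → F.refl)
    ; distrib =
        (λ (matrix f k r _) (matrix g l s _) (matrix h m t _) →
          F.distribˡ f g h , row-distribˡ f k l m s t , λ _ _ → F.refl) ,
        (λ (matrix f k r _) (matrix g l s _) (matrix h m t _) →
          F.distribʳ f g h , row-distribʳ g h k l m r ,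
          λ v → End.+ᴹ-homo r (v ▷ s) (v ▷ t))
    }

  S-isAlgebra : IsAlgebra F S _·_
  S-isAlgebra = record
    { isRing = S-isRing
    ; isLeftModule = record
      { isLeftSemimodule = record
        { +ᴹ-isCommutativeMonoid = IsRing.+-isCommutativeMonoid S-isRing
        ; isPreleftSemimodule = record
          { *ₗ-cong = λ {c} {d} {x} {y} p (q , r , s) →
              F.*-cong p q , L.*ₗ-cong {c} {d} {Matrix.l x} {Matrix.l y} p r ,
              λ v → L.*ₗ-cong {c} {d} {v ▷ Matrix.r x} {v ▷ Matrix.r y} p (s v)
          ; *ₗ-zeroˡ = λ (matrix f l r _) →
              F.zeroˡ f , L.*ₗ-zeroˡ l , λ v → L.*ₗ-zeroˡ (v ▷ r)
          ; *ₗ-distribʳ = λ (matrix f l r _) c d →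
              F.distribʳ f c d , L.*ₗ-distribʳ l c d , λ v → L.*ₗ-distribʳ (v ▷ r) c d
          ; *ₗ-identityˡ = λ (matrix f l r _) →
              F.*-identityˡ f , L.*ₗ-identityˡ l , λ v → L.*ₗ-identityˡ (v ▷ r)
          ; *ₗ-assoc = λ c d (matrix f l r _) →
              F.*-assoc c d f , L.*ₗ-assoc c d l , λ v → L.*ₗ-assoc c d (v ▷ r)
          ; *ₗ-zeroʳ = λ c →
              F.zeroʳ c , L.*ₗ-zeroʳ c , λ _ → L.*ₗ-zeroʳ c
          ; *ₗ-distribˡ = λ c (matrix f l r _) (matrix g m s _) →
              F.distribˡ c f g , L.*ₗ-distribˡ c l m ,
              λ v → L.*ₗ-distribˡ c (v ▷ r) (v ▷ s)
          }
        }
      ; -ᴹ‿cong = λ {x} {y} → IsRing.-‿cong S-isRing {x} {y}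
      ; -ᴹ‿inverse = IsRing.-‿inverse S-isRing
      }
    ; ·-*-assoc = λ c (matrix f k r _) (matrix g l s _) →
        F.*-assoc c f g , row-·-assoc c f k l s , λ v → End.*ₗ-homo s c (v ▷ r)
    ; *-·-comm = λ c (matrix f k r _) (matrix g l s _) →
        x∙yz≈y∙xz f c g , row-·-comm c f (k ▷ s) l , λ _ _ → F.refl
    }
    where
    open CommutativeSemigroupProperties F.*-commutativeSemigroup using (x∙yz≈y∙xz)

  fromEntries : ∀ x → Matrix.f x F.≈ F.0# → Matrix.r x ≈ᴱ 0ᴱ → x ∈ I
  fromEntries x f≈0 r≈0 = Matrix.l x , f≈0 , (λ _ → F.refl) , r≈0

  I-isIdeal : IsTwoSidedIdeal S I
  I-isIdeal = record
    { respects   = λ (p , q , r) (l , p′ , q′ , r′) →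
        l , F.trans (F.sym p) p′ , (λ y → F.trans (F.sym (q y)) (q′ y)) ,
        λ v y → F.trans (F.sym (r v y)) (r′ v y)
    ; 0∈         = fromEntries S.0# F.refl (λ _ _ → F.refl)
    ; +-closed   = λ {x} {y} (_ , p , _ , r) (_ , p′ , _ , r′) →
        fromEntries (x S.+ y) (F.trans (F.+-cong p p′) (F.+-identityˡ F.0#))
          λ v → 0-sub.+-closed (v ▷ Matrix.r x) (v ▷ Matrix.r y) (r v) (r′ v)
    ; neg-closed = λ {x} (_ , p , _ , r) →
        fromEntries (S.- x) (F.trans (F.-‿cong p) -0#≈0#)
          λ v → 0-sub.neg-closed (v ▷ Matrix.r x) (r v)
    ; absorbˡ    = λ s {x} (_ , p , _ , r) →
        fromEntries (s S.* x) (F.trans (F.*-congˡ p) (F.zeroʳ _))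
          λ v → r (v ▷ Matrix.r s)
    ; absorbʳ    = λ s {x} (_ , p , _ , r) →
        fromEntries (x S.* s) (F.trans (F.*-congʳ p) (F.zeroˡ _))
          λ v → IsSubmodule.respects (preimage zeroSubmodule (Matrix.r s))
            L.0ᴹ (v ▷ Matrix.r x) (λ y → F.sym (r v y)) (End.0ᴹ-homo (Matrix.r s))
    }
    where
    open RingProperties F.ring using (-0#≈0#)
    module 0-sub = IsSubmodule zeroSubmodule

  S-ring : Ring a a
  S-ring = IsAlgebra.ring S-isAlgebra

  A : BoundedLattice (lsuc a) a a
  A = idealInterval S-ring I I-isIdeal

  Ideal : Set (lsuc a)
  Ideal = IdealBelow S-ring I I-isIdeal

  embed : L.Carrierᴹ → Matrix
  embed l = matrix F.0# l 0ᴱ 0∈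

  I⇒embed : ∀ x → x ∈ I → x S.≈ embed (Matrix.l x)
  I⇒embed x (_ , p , _ , r) = p , (λ _ → F.refl) , r

  slice : Ideal → Pred L.Carrierᴹ a
  slice J l = embed l ∈ IdealBelow.ideal J

  module _ (J : Ideal) where
    private module J = IdealBelow J

    toSlice : ∀ x → x ∈ J.ideal → Matrix.l x ∈ slice J
    toSlice x x∈J = J.respects {x} {embed (Matrix.l x)} (I⇒embed x (J.below x∈J)) x∈J

    fromSlice : ∀ x → x ∈ I → Matrix.l x ∈ slice J → x ∈ J.ideal
    fromSlice x x∈I l∈J = J.respects {embed (Matrix.l x)} {x}
      (IsRing.sym S-isRing {x} {embed (Matrix.l x)} (I⇒embed x x∈I)) l∈J

    slice-isSubmodule : IsSubmodule (slice J)
    slice-isSubmodule = record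
      { respects = λ v w v≈w → J.respects {embed v} {embed w} (F.refl , v≈w , λ _ _ → F.refl)
      ; 0∈       = toSlice S.0# J.0∈
      ; +-closed = λ v w v∈J w∈J →
          toSlice (embed v S.+ embed w) (J.+-closed {embed v} {embed w} v∈J w∈J)
      ; *-closed = λ c v v∈J →
          -- The upper left entry acts on I from the left by scalars.
          let s = matrix c L.0ᴹ 0ᴱ 0∈ in
          J.respects {s S.* embed v} {embed (c L.*ₗ v)}
            (F.zeroʳ c , L.+ᴹ-identityʳ (c L.*ₗ v) , λ _ _ → F.refl)
            (J.absorbˡ s {embed v} v∈J)
      }

    -- The lower right entry acts on I from the right as an operator in R.
    slice-invariant : R ⊆ Invariant (slice J)
    slice-invariant {t} t∈R v v∈J =
      let s = matrix F.0# L.0ᴹ t t∈R in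
      J.respects {embed v S.* s} {embed (v ▷ t)}
        (F.zeroʳ F.0# , (λ _ → F.refl) , λ _ → End.0ᴹ-homo t)
        (J.absorbʳ s {embed v} v∈J)

  -- In a product with an arbitrary matrix s, the upper right entry of s only meets the vanishing
  -- diagonal entries of x. What survives is a scalar multiple of the vector of x, or its image
  -- under an operator in R.
  fromSubmodule : (N : Pred L.Carrierᴹ a) → IsSubmodule N → R ⊆ Invariant N → Ideal
  fromSubmodule N N-sub N-inv = record
    { ideal = λ x → x ∈ I × Matrix.l x ∈ N
    ; isTwoSidedIdeal = record
      { respects   = λ {x} {y} x≈y@(_ , q , _) (x∈I , l∈N) →
          I.respects {x} {y} x≈y x∈I , N.respects _ _ q l∈N
      ; 0∈         = I.0∈ , N.0∈
      ; +-closed   = λ {x} {y} (x∈I , l∈N) (y∈I , m∈N) →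
          I.+-closed {x} {y} x∈I y∈I , N.+-closed (Matrix.l x) (Matrix.l y) l∈N m∈N
      ; neg-closed = λ {x} (x∈I , l∈N) →
          I.neg-closed {x} x∈I , N.neg-closed (Matrix.l x) l∈N
      ; absorbˡ    = λ s {x} (x∈I@(_ , _ , _ , r≈0) , l∈N) →
          I.absorbˡ s {x} x∈I ,
          N.+-closed _ _ (N.*-closed (Matrix.f s) (Matrix.l x) l∈N)
            (N.respects L.0ᴹ (Matrix.l s ▷ Matrix.r x)
              (λ y → F.sym (r≈0 (Matrix.l s) y)) N.0∈)
      ; absorbʳ    = λ s {x} (x∈I@(_ , f≈0 , _) , l∈N) →
          I.absorbʳ s {x} x∈I ,
          N.+-closed _ _
            (N.respects L.0ᴹ (Matrix.f x L.*ₗ Matrix.l s)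
              (λ y → F.sym (F.trans
                (L.*ₗ-congʳ {Matrix.l s} {Matrix.f x} {F.0#} f≈0 y)
                (L.*ₗ-zeroˡ (Matrix.l s) y)))
              N.0∈)
            (N-inv (Matrix.r∈R s) (Matrix.l x) l∈N)
      }
    ; below = proj₁
    }
    where
    module I = IsTwoSidedIdeal I-isIdeal
    module N = IsSubmodule N-sub

  embed∈I : ∀ l → embed l ∈ I
  embed∈I l = fromEntries (embed l) F.refl λ _ _ → F.refl

-- The operators T on the basis of L

module ImageProperties (em : ∀ {ℓ} → ExcludedMiddle ℓ) {a}
                       (F : CommutativeRing a a) (κ : Ordinal a)
                       (W : Pred (Ordinal.Carrier κ) a) where
  open Construction F κ W
  open Y using (seq)
  open Ordinal κ using (_<_; _≤_; _<?_) renaming (Carrier to K)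
  open OrdinalProperties em κ
  open Endomorphisms F L using (_▷_; End; end; 1ᴱ; _+ᴱ_; -ᴱ_; _*ᴱ_; generator)
  open Submodules F L
  open FreeProperties em F Y-decSetoid
  open IsSubmodule
  private
    module F = CommutativeRing F
    module L = LeftModule L

  size : Seq → ℕ
  size ⟨ _ ⟩   = 0
  size (s ⌢ _) = ℕ.suc (size s)

  amax<bmax : ∀ s → Valid s → amax s < bmax s
  amax<bmax ⟨ _ ⟩         α<β               = α<β
  amax<bmax (s ⌢ (_ , β)) (_ , _ , α<β , _) = <-≤-trans α<β (β≤max (bmax s) β)

  module _ {α β} (α<β : α < β) (α∈W : α ∈ W) where

    ≤-amax-append : ∀ η → α ≤ amax (seq (append α<β α∈W η))
    ≤-amax-append (s , _) with amax s <? α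
    ... | yes _  = ≤-refl
    ... | no s≮α = ≮⇒≥ s≮α

    append-fixes : ∀ η → α ≤ amax (seq η) → append α<β α∈W η ≡ η
    append-fixes (s , _) α≤s with amax s <? α
    ... | yes s<α = contradiction α≤s (<⇒≱ s<α)
    ... | no  _   = refl

    append-cong : ∀ η θ → seq η ≡ seq θ →
                  seq (append α<β α∈W η) ≡ seq (append α<β α∈W θ)
    append-cong (s , _) (.s , _) refl with amax s <? α
    ... | yes _ = refl
    ... | no  _ = refl

  basis? : Maybe Y → L.Carrierᴹ
  basis? = maybe basis L.0ᴹ

  basis-cong : ∀ η θ → seq η ≡ seq θ → basis η L.≈ᴹ basis θ
  basis-cong (s , _) (.s , _) refl _ = F.refl

  module _ (ν ρ : Y) where

    image-step : ∀ η {θ} → image ν ρ η ≡ just θ →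
      (seq η ≡ seq ν × ρ ≡ θ) ⊎
      (∃[ ζ ] ∃[ α ] ∃[ β ] Σ[ α<β ∈ α < β ] Σ[ α∈W ∈ α ∈ W ] ∃[ ξ ]
        seq η ≡ seq ζ ⌢ (α , β) × image ν ρ ζ ≡ just ξ × append α<β α∈W ξ ≡ θ)
    image-step (s , _) eq with s ≟ˢ seq ν
    image-step (s , _) refl | yes s≡ν = inj₁ (s≡ν , refl)
    image-step (s ⌢ (α , β) , (v , _ , α<β , α∈W)) eq | no _
      with imageSeq ν ρ s v in eq′
    image-step (s ⌢ (α , β) , (v , _ , α<β , α∈W)) refl | no _ | just ξ =
      inj₂ ((s , v) , α , β , α<β , α∈W , ξ , refl , eq′ , refl)

    image-self : ∀ η → seq η ≡ seq ν → image ν ρ η ≡ just ρ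
    image-self (s , _) s≡ν with s ≟ˢ seq ν
    ... | yes _  = refl
    ... | no s≢ν = contradiction s≡ν s≢ν

    -- A non-zero image requires ν to be an initial segment of η; its consequence for sizes is all
    -- that is used later.
    image-size : ∀ η {θ} → image ν ρ η ≡ just θ →
                 seq η ≡ seq ν ⊎ size (seq ν) ℕ.< size (seq η)
    image-size (s , v) = go s v
      where
      go : ∀ s v {θ} → image ν ρ (s , v) ≡ just θ →
           s ≡ seq ν ⊎ size (seq ν) ℕ.< size s
      go s v eq with s ≟ˢ seq ν
      go s v eq | yes s≡ν = inj₁ s≡ν
      go (s ⌢ (α , β)) (v , _) eq | no _ with imageSeq ν ρ s v in eq′
      ... | just _ with go s v eq′
      ...   | inj₁ refl = inj₂ ℕ.≤-refl
      ...   | inj₂ lt   = inj₂ (ℕ.m≤n⇒m≤1+n lt)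

    -- At η = ν this is amax ν < bmax ν ≤ amax ρ. At a proper extension of ν, `append` brings the
    -- image up to at least the last α of η. Invariance of V_α under R follows.
    image-amax : bmax (seq ν) ≤ amax (seq ρ) → ∀ η {θ} → image ν ρ η ≡ just θ →
                 amax (seq η) ≤ amax (seq θ)
    image-amax ν≤ρ (s , v) eq with image-step (s , v) eq
    ... | inj₁ (refl , refl) = inj₁ (<-≤-trans (amax<bmax s v) ν≤ρ)
    ... | inj₂ (_ , _ , _ , α<β , α∈W , ξ , refl , _ , refl) = ≤-amax-append α<β α∈W ξ

    -- The only clash occurs when ν is η with (α,β) appended: T kills η but not its extension, and β
    -- ≤ bmax ν ≤ amax ρ. If amax η ≥ α, nothing is appended to η, nor to its image by `image-amax`.
    image-append : ∀ {α β} (α<β : α < β) (α∈W : α ∈ W) η →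
      bmax (seq ν) ≤ amax (seq ρ) →
      (image ν ρ (append α<β α∈W η) ≡ just ρ × image ν ρ η ≡ nothing × β ≤ amax (seq ρ)) ⊎
      image ν ρ (append α<β α∈W η) ≡ Maybe.map (append α<β α∈W) (image ν ρ η)
    image-append {α} {β} α<β α∈W η@(s , v) ν≤ρ with amax s <? α
    ... | no s≮α with image ν ρ η in eq
    ...   | nothing = inj₂ refl
    ...   | just θ  = inj₂ (≡.cong just (≡.sym (append-fixes α<β α∈W θ
                        (≤-trans (≮⇒≥ s≮α) (image-amax ν≤ρ η eq)))))
    image-append {α} {β} α<β α∈W η@(s , v) ν≤ρ | yes s<α
      with (s ⌢ (α , β)) ≟ˢ seq ν
    ... | no  _    = inj₂ refl
    ... | yes refl = inj₁ (refl , unreached , ≤-trans (β≤max (bmax s) β) ν≤ρ)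
      where
      unreached : image ν ρ η ≡ nothing
      unreached with image ν ρ η in eq
      ... | nothing = refl
      ... | just _ with image-size η eq
      ...   | inj₁ s≡ν = contradiction (≡.sym (≡.cong size s≡ν)) ℕ.1+n≢n
      ...   | inj₂ lt  = contradiction (ℕ.n≤1+n _) (ℕ.<⇒≱ lt)

    basis-▷T : ∀ η → basis η ▷ T ν ρ L.≈ᴹ basis? (image ν ρ η)
    basis-▷T = extend-basis (onBasis-func ν ρ)

    supported-▷T : ∀ {q p} (Q : Pred Y q) → Extensional Q →
      {N : Pred L.Carrierᴹ p} → IsSubmodule N →
      (∀ η {θ} → Q η → image ν ρ η ≡ just θ → basis θ ∈ N) →
      ∀ v → v ∈ Supported Q → v ▷ T ν ρ ∈ N
    supported-▷T Q ext {N} N-sub basis∈N = supported-span Q ext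
      (preimage N-sub (T ν ρ))
      (λ η q → respects N-sub (basis? (image ν ρ η)) (basis η ▷ T ν ρ)
                 (L.≈ᴹ-sym {basis η ▷ T ν ρ} {basis? (image ν ρ η)} (basis-▷T η))
                 (image∈N η q))
      where
      image∈N : ∀ η → Q η → basis? (image ν ρ η) ∈ N
      image∈N η q with image ν ρ η in eq
      ... | nothing = 0∈ N-sub
      ... | just θ  = basis∈N η q eq

    T∈R : bmax (seq ν) ≤ amax (seq ρ) → T ν ρ ∈ R
    T∈R ν≤ρ = generator (ν , ρ , ν≤ρ , λ v → L.≈ᴹ-refl {v ▷ T ν ρ})

  FromAbove : K → Pred Y a
  FromAbove α η = α ≤ amax (seq η)

  fromAbove-extensional : ∀ α → Extensional (FromAbove α)
  fromAbove-extensional α _ _ eq = subst (λ s → α ≤ amax s) eq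

  Above : K → Pred L.Carrierᴹ a
  Above α = Supported (FromAbove α)

  above-isSubmodule : ∀ α → IsSubmodule (Above α)
  above-isSubmodule α = supported-isSubmodule (FromAbove α)

  basis∈above : ∀ {α} η → α ≤ amax (seq η) → basis η ∈ Above α
  basis∈above {α} η = basis-supported (FromAbove α) (fromAbove-extensional α) η

  above-antitone : ∀ {α β} → α ≤ β → ∀ v → v ∈ Above β → v ∈ Above α
  above-antitone α≤β v v∈ η α≰η = v∈ η (α≰η ∘ ≤-trans α≤β)

  above-invariant : ∀ α → R ⊆ Invariant (Above α)
  above-invariant α = generated-invariant (above-isSubmodule α)
    λ {t} (ν , ρ , ν≤ρ , t≈T) v v∈ →
      respects (above-isSubmodule α) (v ▷ T ν ρ) (v ▷ t)
        (L.≈ᴹ-sym {v ▷ t} {v ▷ T ν ρ} (t≈T v))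
        (supported-▷T ν ρ (FromAbove α) (fromAbove-extensional α) (above-isSubmodule α)
          (λ η {θ} α≤η eq → basis∈above θ (≤-trans α≤η (image-amax ν ρ ν≤ρ η eq)))
          v v∈)

  -- For η of maximal size among the sequences occurring in v, the operator
  -- T_{ηρ} annihilates every term of v except the one at η.

  above-cofinal : IsField F → ∀ {p} {N : Pred L.Carrierᴹ p} → IsSubmodule N →
    R ⊆ Invariant N → ∀ v → v ∈ N → ¬ v L.≈ᴹ L.0ᴹ →
    ∃[ α ] (∀ w → w ∈ Above α → w ∈ N)
  above-cofinal F-field {N = N} N-sub N-inv v v∈N v≉0 =
    bmax (seq η) , supported-span (FromAbove _) (fromAbove-extensional _) N-sub basis∈N
    where
    open IsField F-field
    open Free F Y-decSetoid using (coeff)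
    top = maximal-coefficient (size ∘ seq) (λ _ _ eq → ℕ.≤-reflexive (≡.cong size eq)) v v≉0
    η = proj₁ top
    c = coeff v η
    u w : L.Carrierᴹ
    w = c L.*ₗ basis η
    u = v L.+ᴹ L.-ᴹ w

    u▷T≈0 : ∀ ρ → u ▷ T η ρ L.≈ᴹ L.0ᴹ
    u▷T≈0 ρ = supported-▷T η ρ (Remaining v η) (remaining-extensional v η) zeroSubmodule
      (λ θ {ξ} (η≢θ , vθ≉0) eq → annihilated θ ξ η≢θ vθ≉0 (image-size η ρ θ eq))
      u (minus-term v η)
      where
      annihilated : ∀ θ ξ → ¬ seq η ≡ seq θ → ¬ coeff v θ F.≈ F.0# →
                    seq θ ≡ seq η ⊎ size (seq η) ℕ.< size (seq θ) →
                    basis ξ L.≈ᴹ L.0ᴹ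
      annihilated θ ξ η≢θ vθ≉0 (inj₁ θ≡η) = contradiction (≡.sym θ≡η) η≢θ
      annihilated θ ξ η≢θ vθ≉0 (inj₂ η<θ) = contradiction (proj₂ (proj₂ top) θ η<θ) vθ≉0

    v▷T≈cρ : ∀ ρ → v ▷ T η ρ L.≈ᴹ c L.*ₗ basis ρ
    v▷T≈cρ ρ = begin
      v ▷ T η ρ                  ≈⟨ End.apply-cong (T η ρ) {u L.+ᴹ w} {v} (difference-+ v w) ⟨
      (u L.+ᴹ w) ▷ T η ρ         ≈⟨ End.+ᴹ-homo (T η ρ) u w ⟩
      u ▷ T η ρ L.+ᴹ w ▷ T η ρ   ≈⟨ L.+ᴹ-cong {u ▷ T η ρ} {L.0ᴹ} {w ▷ T η ρ} {c L.*ₗ (basis η ▷ T η ρ)}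
                                      (u▷T≈0 ρ) (End.*ₗ-homo (T η ρ) c (basis η)) ⟩
      c L.*ₗ (basis η ▷ T η ρ)   ≈⟨ L.*ₗ-congˡ {c} {basis η ▷ T η ρ} {basis ρ} η▷T≈ρ ⟩
      c L.*ₗ basis ρ             ∎
      where
      open SetoidReasoning L.≈ᴹ-setoid
      η▷T≈ρ : basis η ▷ T η ρ L.≈ᴹ basis ρ
      η▷T≈ρ = subst (λ m → basis η ▷ T η ρ L.≈ᴹ basis? m) (image-self η ρ η refl)
                (basis-▷T η ρ η)

    basis∈N : ∀ ρ → bmax (seq η) ≤ amax (seq ρ) → basis ρ ∈ N
    basis∈N ρ η≤ρ = *ₗ-cancel N-sub {c} (proj₂ (inverse c (proj₁ (proj₂ top)))) (basis ρ)
      (respects N-sub (v ▷ T η ρ) (c L.*ₗ basis ρ) (v▷T≈cρ ρ)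
        (N-inv (T∈R η ρ η≤ρ) v v∈N))

  -- The projection onto V_α and the complement it defines

  module Projection {α β} (α<β : α < β) (α∈W : α ∈ W) where

    private
      extend′ : Func (DecSetoid.setoid Y-decSetoid) L.≈ᴹ-setoid
      extend′ = record
        { to   = λ η → basis (append α<β α∈W η)
        ; cong = λ {η} {θ} η≡θ → basis-cong (append α<β α∈W η) (append α<β α∈W θ)
                                   (append-cong α<β α∈W η θ η≡θ)
        }
      module E = Extension L extend′

    π : End
    π = end E.extend E.extend-isHomomorphism

    basis?-▷π : ∀ m → basis? m ▷ π L.≈ᴹ basis? (Maybe.map (append α<β α∈W) m)
    basis?-▷π nothing  = L.≈ᴹ-refl {L.0ᴹ}
    basis?-▷π (just η) = extend-basis extend′ η

    π-above : ∀ v → v ▷ π ∈ Above α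
    π-above = basis-span (preimage (above-isSubmodule α) π) λ η →
      respects (above-isSubmodule α) (basis (append α<β α∈W η)) (basis η ▷ π)
        (L.≈ᴹ-sym {basis η ▷ π} {basis (append α<β α∈W η)} (basis?-▷π (just η)))
        (basis∈above (append α<β α∈W η) (≤-amax-append α<β α∈W η))

    π-fixes : ∀ v → v ∈ Above α → v ▷ π L.≈ᴹ v
    π-fixes = supported-span (FromAbove α) (fromAbove-extensional α) (equalizer π 1ᴱ)
      λ η α≤η → subst (λ θ → basis η ▷ π L.≈ᴹ basis θ) (append-fixes α<β α∈W η α≤η)
                  (basis?-▷π (just η))

    -- On a basis vector `image-append` leaves two cases: the two composites agree, or their
    -- difference is -x_ρ with β ≤ amax ρ.
    commutator∈above : ∀ ν ρ → bmax (seq ν) ≤ amax (seq ρ) →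
      ∀ v → v ▷ (T ν ρ *ᴱ π +ᴱ -ᴱ (π *ᴱ T ν ρ)) ∈ Above β
    commutator∈above ν ρ ν≤ρ = basis-span
      (preimage (above-isSubmodule β) (T ν ρ *ᴱ π +ᴱ -ᴱ (π *ᴱ T ν ρ)))
      λ η → respects (above-isSubmodule β)
        (basis? (⁺ (image ν ρ η)) L.+ᴹ L.-ᴹ basis? (image ν ρ (append α<β α∈W η)))
        (basis η ▷ T ν ρ ▷ π L.+ᴹ L.-ᴹ (basis η ▷ π ▷ T ν ρ))
        (L.≈ᴹ-sym {basis η ▷ T ν ρ ▷ π L.+ᴹ L.-ᴹ (basis η ▷ π ▷ T ν ρ)}
                  {basis? (⁺ (image ν ρ η)) L.+ᴹ L.-ᴹ basis? (image ν ρ (append α<β α∈W η))}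
          (L.+ᴹ-cong {basis η ▷ T ν ρ ▷ π} {basis? (⁺ (image ν ρ η))}
                     {L.-ᴹ (basis η ▷ π ▷ T ν ρ)}
                     {L.-ᴹ basis? (image ν ρ (append α<β α∈W η))}
            (Tπ η)
            (L.-ᴹ‿cong {basis η ▷ π ▷ T ν ρ} {basis? (image ν ρ (append α<β α∈W η))} (πT η))))
        (difference∈above (image ν ρ η) (image ν ρ (append α<β α∈W η))
          (image-append ν ρ α<β α∈W η ν≤ρ))
      where
      ⁺ : Maybe Y → Maybe Y
      ⁺ = Maybe.map (append α<β α∈W)

      Tπ : ∀ η → basis η ▷ T ν ρ ▷ π L.≈ᴹ basis? (⁺ (image ν ρ η))
      Tπ η = L.≈ᴹ-trans {basis η ▷ T ν ρ ▷ π} {basis? (image ν ρ η) ▷ π} {basis? (⁺ (image ν ρ η))}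
        (End.apply-cong π {basis η ▷ T ν ρ} {basis? (image ν ρ η)} (basis-▷T ν ρ η))
        (basis?-▷π (image ν ρ η))

      πT : ∀ η → basis η ▷ π ▷ T ν ρ L.≈ᴹ basis? (image ν ρ (append α<β α∈W η))
      πT η = L.≈ᴹ-trans {basis η ▷ π ▷ T ν ρ} {basis (append α<β α∈W η) ▷ T ν ρ}
                        {basis? (image ν ρ (append α<β α∈W η))}
        (End.apply-cong (T ν ρ) {basis η ▷ π} {basis (append α<β α∈W η)} (basis?-▷π (just η)))
        (basis-▷T ν ρ (append α<β α∈W η))

      difference∈above : ∀ m m⁺ →
        (m⁺ ≡ just ρ × m ≡ nothing × β ≤ amax (seq ρ)) ⊎ m⁺ ≡ ⁺ m →
        basis? (⁺ m) L.+ᴹ L.-ᴹ basis? m⁺ ∈ Above β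
      difference∈above m m⁺ (inj₁ (refl , refl , β≤ρ)) =
        neg-closed (above-isSubmodule β) (basis ρ) (basis∈above ρ β≤ρ)
      difference∈above m m⁺ (inj₂ refl) = respects (above-isSubmodule β)
        L.0ᴹ (basis? (⁺ m) L.+ᴹ L.-ᴹ basis? (⁺ m))
        (L.≈ᴹ-sym {basis? (⁺ m) L.+ᴹ L.-ᴹ basis? (⁺ m)} {L.0ᴹ} (L.-ᴹ‿inverseʳ (basis? (⁺ m))))
        (0∈ (above-isSubmodule β))

    Complement : Pred L.Carrierᴹ a
    Complement v = v ▷ π ∈ Above β

    complement-isSubmodule : IsSubmodule Complement
    complement-isSubmodule = preimage (above-isSubmodule β) π

    -- Write vTπ = (vTπ - vπT) + vπT: the commutator takes values in V_β, and vπ ∈ V_β stays there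
    -- under T.
    complement-invariant : R ⊆ Invariant Complement
    complement-invariant = generated-invariant complement-isSubmodule
      λ {t} (ν , ρ , ν≤ρ , t≈T) v vπ∈ →
        let Tπ = v ▷ T ν ρ ▷ π
            πT = v ▷ π ▷ T ν ρ
        in respects complement-isSubmodule (v ▷ T ν ρ) (v ▷ t)
             (L.≈ᴹ-sym {v ▷ t} {v ▷ T ν ρ} (t≈T v))
             (respects (above-isSubmodule β) ((Tπ L.+ᴹ L.-ᴹ πT) L.+ᴹ πT) Tπ
               (difference-+ Tπ πT)
               (+-closed (above-isSubmodule β) (Tπ L.+ᴹ L.-ᴹ πT) πT
                 (commutator∈above ν ρ ν≤ρ v)
                 (above-invariant β (T∈R ν ρ ν≤ρ) (v ▷ π) vπ∈)))

    complement-∩ : ∀ v → v ∈ Above α → v ∈ Complement → v ∈ Above β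
    complement-∩ v v∈ vπ∈ = respects (above-isSubmodule β) (v ▷ π) v (π-fixes v v∈) vπ∈

    above⊆complement : ∀ v → v ∈ Above β → v ∈ Complement
    above⊆complement v v∈ = respects (above-isSubmodule β) v (v ▷ π)
      (L.≈ᴹ-sym {v ▷ π} {v} (π-fixes v (above-antitone (inj₁ α<β) v v∈))) v∈

    -- π is the identity on V_α, which contains all its values; hence π is idempotent and
    -- annihilates v - vπ.
    complement-+ : ∀ v → v L.+ᴹ L.-ᴹ (v ▷ π) ∈ Complement
    complement-+ v = respects (above-isSubmodule β) L.0ᴹ ((v L.+ᴹ L.-ᴹ (v ▷ π)) ▷ π)
      (L.≈ᴹ-sym {(v L.+ᴹ L.-ᴹ (v ▷ π)) ▷ π} {L.0ᴹ} (begin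
        (v L.+ᴹ L.-ᴹ (v ▷ π)) ▷ π            ≈⟨ End.+ᴹ-homo π v (L.-ᴹ (v ▷ π)) ⟩
        v ▷ π L.+ᴹ (L.-ᴹ (v ▷ π)) ▷ π        ≈⟨ L.+ᴹ-congˡ {v ▷ π} {(L.-ᴹ (v ▷ π)) ▷ π} {L.-ᴹ (v ▷ π)}
                                                  (π-fixes (L.-ᴹ (v ▷ π)) (neg-closed (above-isSubmodule α) (v ▷ π) (π-above v))) ⟩
        v ▷ π L.+ᴹ L.-ᴹ (v ▷ π)              ≈⟨ L.-ᴹ‿inverseʳ (v ▷ π) ⟩
        L.0ᴹ                                 ∎))
      (0∈ (above-isSubmodule β))
      where open SetoidReasoning L.≈ᴹ-setoid

  -- Since θ properly extends ν, amax θ lies in W and so differs from α.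

  image-skips : ∀ {α} → ¬ α ∈ W → ∀ ν ρ → amax (seq ν) < α →
    ∀ θ {ξ} → α ≤ amax (seq θ) → image ν ρ θ ≡ just ξ → α < amax (seq ξ)
  image-skips α∉W ν ρ ν<α (s , _) α≤θ eq with image-step ν ρ (s , _) eq
  ... | inj₁ (refl , _) = contradiction α≤θ (<⇒≱ ν<α)
  ... | inj₂ (_ , _ , _ , α′<β′ , α′∈W , ξ , refl , _ , refl) =
    <-≤-trans (strict α∉W α′∈W α≤θ) (≤-amax-append α′<β′ α′∈W ξ)
    where
    strict : ∀ {α α′} → ¬ α ∈ W → α′ ∈ W → α ≤ α′ → α < α′
    strict α∉W α′∈W (inj₁ α<α′) = α<α′
    strict α∉W α′∈W (inj₂ refl) = contradiction α′∈W α∉W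

-- The chain of submodules supported from α on

module AboveChain (em : ∀ {ℓ} → ExcludedMiddle ℓ) {a}
                  (F : CommutativeRing a a) (F-field : IsField F)
                  (κ : Ordinal a) (κ-regular : IsRegularUncountable κ)
                  (W : Pred (Ordinal.Carrier κ) a)
                  (0∈W : ∀ α → Ordinal.IsZero κ α → α ∈ W) where
  open Construction F κ W
  open Y using (seq)
  open Ordinal κ using (_<_; _≤_) renaming (Carrier to K)
  open OrdinalProperties em κ
  open RegularProperties em κ κ-regular
  open Endomorphisms F L using (_▷_; End)
  open Submodules F L
  open IsSubmodule
  open FreeProperties em F Y-decSetoid
  open ImageProperties em F κ W
  open TriangularAlgebra F κ W
  open ChainProperties em A
  private
    module F = CommutativeRing F
    module L = LeftModule L

  aboveIdeal : K → Ideal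
  aboveIdeal α = fromSubmodule (Above α) (above-isSubmodule α) (above-invariant α)

  -- The first pair is exempt from the condition on W, so every α is the amax of some sequence. This
  -- makes the chain strictly decreasing and supplies ρ in `notComplemented`.
  single : ∀ {α β} → α < β → Y
  single α<β = ⟨ _ , _ ⟩ , α<β

  basis∉above : ∀ η {α} → amax (seq η) < α → ¬ basis η ∈ Above α
  basis∉above η {α} η<α η∈ =
    <⇒≱ η<α (supported-basis (IsField.1≉0 F-field) (FromAbove α) η η∈)

  basis≉0 : ∀ η → ¬ basis η L.≈ᴹ L.0ᴹ
  basis≉0 η η≈0 = IsField.1≉0 F-field
    (F.trans (F.sym (coeff-basis-self η η refl)) (η≈0 η))

  aboveChain : CDC A κ
  aboveChain = record
    { term       = aboveIdeal
    ; nonzero    = λ α (above⊆0 , _) →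
        let η = single (<-next α) in
        basis≉0 η (proj₁ (proj₂ (above⊆0 {embed (basis η)}
          (embed∈I (basis η) , basis∈above η ≤-refl))))
    ; atZero     = λ α α≡0 →
        proj₁ ,
        λ x∈I → x∈I , λ η α≰η → contradiction (≮⇒≥ (α≡0 (amax (seq η)))) α≰η
    ; atLimit    = λ α (_ , dense) →
        (λ β β<α {x} (x∈I , x∈) → x∈I , above-antitone (inj₁ β<α) (Matrix.l x) x∈) ,
        λ J J≤ {x} x∈J → IdealBelow.below J x∈J , λ η α≰η →
          -- Each coefficient is treated separately: J ≤ V_γ with amax η < γ already forces the one
          -- at η to vanish.
          let γ , η<γ , γ<α = dense (amax (seq η)) (≰⇒> α≰η) in
          proj₂ (J≤ γ γ<α {x} x∈J) η (<⇒≱ η<γ)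
    ; decreasing = λ α β (α<β , _) →
        (λ {x} (x∈I , x∈) → x∈I , above-antitone (inj₁ α<β) (Matrix.l x) x∈) ,
        λ (_ , α⊆β) →
          let η = single α<β in
          basis∉above η α<β (proj₂ (α⊆β {embed (basis η)}
            (embed∈I (basis η) , basis∈above η ≤-refl)))
    ; cofinal    = λ J J≉0 →
        let v , v∈J , v≉0 = nonzeroElement J J≉0
            α , above⊆J = above-cofinal F-field (slice-isSubmodule J)
                            (slice-invariant J) v v∈J v≉0
        in α , λ {x} (x∈I , x∈) → fromSlice J x x∈I (above⊆J (Matrix.l x) x∈)
    }
    where
    nonzeroElement : ∀ J → ¬ BoundedLattice._≈_ A J (BoundedLattice.⊥ A) →
                     ∃[ v ] v ∈ slice J × ¬ v L.≈ᴹ L.0ᴹ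
    nonzeroElement J J≉0 = decidable-stable em λ ¬∃ → J≉0
      ( (λ {x} x∈J → let _ , f≈0 , _ , r≈0 = IdealBelow.below J x∈J in
           f≈0 ,
           decidable-stable em (λ l≉0 → ¬∃ (Matrix.l x , toSlice J x x∈J , l≉0)) ,
           r≈0)
      , BoundedLattice.minimum A J )

  open BoundedLattice A using (_∨_)

  complemented : ∀ {α β} → α ∈ W → α < β →
                 ComplementedOver A (aboveIdeal α) (aboveIdeal β)
  complemented {α} {β} α∈W α<β =
    C ,
    ( (λ {x} ((x∈I , x∈) , (_ , xπ∈)) → x∈I , complement-∩ (Matrix.l x) x∈ xπ∈)
    , (λ {x} (x∈I , x∈) →
        (x∈I , above-antitone (inj₁ α<β) (Matrix.l x) x∈) ,
        (x∈I , above⊆complement (Matrix.l x) x∈)) ) ,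
    ( (λ {x} → IdealBelow.below (aboveIdeal α ∨ C) {x})
    , λ {x} x∈I@(_ , f≈0 , _ , r≈0) →
        let l = Matrix.l x in
        embed (l ▷ π) , embed (l L.+ᴹ L.-ᴹ (l ▷ π)) ,
        (embed∈I (l ▷ π) , π-above l) ,
        (embed∈I (l L.+ᴹ L.-ᴹ (l ▷ π)) , complement-+ l) ,
        F.trans f≈0 (F.sym (F.+-identityˡ F.0#)) ,
        L.≈ᴹ-sym {l ▷ π L.+ᴹ (l L.+ᴹ L.-ᴹ (l ▷ π))} {l}
          (L.≈ᴹ-trans {l ▷ π L.+ᴹ (l L.+ᴹ L.-ᴹ (l ▷ π))} {(l L.+ᴹ L.-ᴹ (l ▷ π)) L.+ᴹ l ▷ π} {l}
            (L.+ᴹ-comm (l ▷ π) (l L.+ᴹ L.-ᴹ (l ▷ π))) (difference-+ l (l ▷ π))) ,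
        r≈0 )
    where
    open Projection α<β α∈W
    C = fromSubmodule Complement complement-isSubmodule complement-invariant

  -- In a complement, x_η = w + u with w supported from α on, where η = ⟨(ζ,α)⟩
  -- and ζ < α.  Applying T_{ηρ} with amax ρ = α gives x_ρ = wT + uT, and both
  -- summands are supported strictly above α.

  notComplemented : ∀ {α β} → ¬ α ∈ W → α < β →
                    ¬ ComplementedOver A (aboveIdeal α) (aboveIdeal β)
  notComplemented {α} {β} α∉W α<β (J , (α∧J≤β , _) , (_ , ⊤≤α∨J))
    -- α is not zero, because zero lies in W and α does not.
    with ζ , ζ<α ← decidable-stable (em {P = ∃[ ζ ] ζ < α})
           (λ none → α∉W (0∈W α λ ζ ζ<α → none (ζ , ζ<α)))
    with y , z , (_ , w∈) , z∈J , (_ , η≈w+u , _) ←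
           ⊤≤α∨J {embed (basis (single ζ<α))} (embed∈I (basis (single ζ<α))) =
    <⇒≱ (supported-basis (IsField.1≉0 F-field) StrictlyAbove ρ
      (respects strictlyAbove-isSubmodule (w ▷ t L.+ᴹ u ▷ t) (basis ρ)
        (L.≈ᴹ-sym {basis ρ} {w ▷ t L.+ᴹ u ▷ t} ρ≈wt+ut)
        (+-closed strictlyAbove-isSubmodule (w ▷ t) (u ▷ t) wt∈ ut∈))) ≤-refl
    where
    η ρ : Y
    η = single ζ<α
    ρ = single (<-next α)
    t = T η ρ
    -- The borderline case of the condition on generators: bmax η = α = amax ρ.
    t∈R = T∈R η ρ ≤-refl
    w u : L.Carrierᴹ
    w = Matrix.l y
    u = Matrix.l z

    StrictlyAbove : Pred Y a
    StrictlyAbove θ = α < amax (seq θ)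

    strictlyAbove-isSubmodule : IsSubmodule (Supported StrictlyAbove)
    strictlyAbove-isSubmodule = supported-isSubmodule StrictlyAbove

    ρ≈wt+ut : basis ρ L.≈ᴹ w ▷ t L.+ᴹ u ▷ t
    ρ≈wt+ut = begin
      basis ρ                ≈⟨ subst (λ m → basis η ▷ t L.≈ᴹ basis? m) (image-self η ρ η refl)
                                  (basis-▷T η ρ η) ⟨
      basis η ▷ t            ≈⟨ End.apply-cong t {basis η} {w L.+ᴹ u} η≈w+u ⟩
      (w L.+ᴹ u) ▷ t         ≈⟨ End.+ᴹ-homo t w u ⟩
      w ▷ t L.+ᴹ u ▷ t       ∎
      where open SetoidReasoning L.≈ᴹ-setoid

    wt∈ : w ▷ t ∈ Supported StrictlyAbove
    wt∈ = supported-▷T η ρ (FromAbove α) (fromAbove-extensional α) strictlyAbove-isSubmodule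
      (λ θ {ξ} α≤θ θ↦ξ → basis-supported StrictlyAbove (λ _ _ eq → subst (λ s → α < amax s) eq) ξ
        (image-skips α∉W η ρ ζ<α θ α≤θ θ↦ξ))
      w w∈

    -- Since x_ρ and wT lie in V_α, so does uT = x_ρ - wT. As u lies in the invariant J, uT lies in
    -- V_α ∩ J ⊆ V_β, and β is beyond α.
    ut∈above : u ▷ t ∈ Above α
    ut∈above = respects (above-isSubmodule α) ((u ▷ t L.+ᴹ w ▷ t) L.+ᴹ L.-ᴹ (w ▷ t)) (u ▷ t)
      (difference (u ▷ t) (w ▷ t))
      (+-closed (above-isSubmodule α) (u ▷ t L.+ᴹ w ▷ t) (L.-ᴹ (w ▷ t))
        (respects (above-isSubmodule α) (basis ρ) (u ▷ t L.+ᴹ w ▷ t)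
          (L.≈ᴹ-trans {basis ρ} {w ▷ t L.+ᴹ u ▷ t} {u ▷ t L.+ᴹ w ▷ t}
            ρ≈wt+ut (L.+ᴹ-comm (w ▷ t) (u ▷ t)))
          (basis∈above ρ ≤-refl))
        (neg-closed (above-isSubmodule α) (w ▷ t) (above-invariant α t∈R w w∈)))

    ut∈ : u ▷ t ∈ Supported StrictlyAbove
    ut∈ θ α≮θ = proj₂ (α∧J≤β {embed (u ▷ t)}
      ((embed∈I (u ▷ t) , ut∈above) , slice-invariant J t∈R u (toSlice J z z∈J)))
      θ λ β≤θ → α≮θ (<-≤-trans α<β β≤θ)

  aboveChain-exceptional : ∀ α → exceptional A aboveChain α ⇔ (α ∈ ∁ W)
  aboveChain-exceptional α = mk⇔
    (λ (β , α<β , ¬complemented) α∈W → ¬complemented (complemented α∈W α<β))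
    (λ α∉W → next α , <-next α , notComplemented α∉W (<-next α))

corollary3p1 : (∀ {ℓ} → ExcludedMiddle ℓ) →
    ∀ {a} (F : CommutativeRing a a) → IsField F →
    (κ : Ordinal a) → IsRegularUncountable κ →
    (i W : Pred (Ordinal.Carrier κ) a) →
    (∀ α → Ordinal.IsZero κ α → α ∈ W) →
    ClubEq κ (∁ W) i →
    let open Construction F κ W in
    Σ[ S-isAlgebra ∈ IsAlgebra F S _·_ ]
    Σ[ I-isIdeal ∈ IsTwoSidedIdeal S I ]
    let A = idealInterval (IsAlgebra.ring S-isAlgebra) I I-isIdeal in
    IsStronglyDenseOfDimension A κ × Γ≡ A κ i
corollary3p1 em F F-field κ κ-regular i W 0∈W ∁W≡i =
  S-isAlgebra , I-isIdeal ,
  record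
    { modular = modular
    ; cdc     = aboveChain
    ; least   = length-≼ κ-regular aboveChain
    } ,
  λ U → let C , C-club , agree = Γ-independent em A modular κ κ-regular U aboveChain in
    ClubEq-trans
      (C , C-club , λ α α∈C → aboveChain-exceptional α ⇔-∘ agree α α∈C)
      ∁W≡i
  where
  open TriangularAlgebra F κ W
  open AboveChain em F F-field κ κ-regular W 0∈W
  open RegularProperties em κ κ-regular using (ClubEq-trans)
  open ChainProperties em A using (length-≼)
  modular : IsModular A
  modular = idealInterval-modular S-ring I I-isIdeal
    where open Construction F κ W using (I)
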